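{- Let $P$ be a poset on $[n]$. There is a bijection $\Phi:\mathfrak{S}^{\pitchfork}(P)\to\mathcal{L}(P)$ such that $\operatorname{cyc}(\tau)={\sf LRmax}_P(\Phi(\tau))$ for all $\tau\in\mathfrak{S}^{\pitchfork}(P)$. Consequently \[ {\sf Poin}(P,t)=\sum_{\sigma\in\mathcal{L}(P)} t^{\,n-{\sf LRmax}_P(\sigma)}. \]
   Context: Braid arrangement: in $V=\mathbb{R}^n$ let $H_{ij}=\{x: x_i=x_j\}$, $1\le i<j\le n$; $\mathcal{L}$ is the set of intersections of subsets of these hyperplanes ($V$ included), ordered by reverse inclusion, with Möbius function $\mu$. For a poset $P$ on $[n]$, $\mathcal{K}_P=\{x: x_i<x_j \text{ whenever } i<_P j\}$, $\mathcal{L}^{int}(\mathcal{K}_P)=\{X\in\mathcal{L}:X\cap\mathcal{K}_P\ne\emptyset\}$, $c_k(P)=\sum_{X\in\mathcal{L}^{int}(\mathcal{K}_P),\operatorname{codim}X=k}|\mu(V,X)|$, ${\sf Poin}(P,t)=\sum_k c_k(P)t^k$. $\mathcal{L}(P)$ is the set of linear extensions of $P$: permutations $\sigma=[\sigma_1,\dots,\sigma_n]$ of $[n]$ with $i<_P j$ implying $i$ appears before $j$. For a set partition $\pi$ of $[n]$, $P/\pi$ is the preposet on blocks obtained as transitive closure of $B\le B'$ whenever $p\le_P q$ for some $p\in B,q\in B'$; $\pi$ is $P$-transverse if its blocks are antichains of $P$ and $P/\pi$ is a poset. $\mathfrak{S}^{\pitchfork}(P)$ is the set of permutations of $[n]$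 whose cycle partition is $P$-transverse; $\operatorname{cyc}(\tau)$ is the number of cycles. For $\sigma\in\mathcal{L}(P)$: Level 1 consists of the entries of the longest initial segment $\sigma_1,\dots,\sigma_r$ forming an antichain of $P$; recursively, if Levels $1,\dots,k-1$ consist of $\sigma_1,\dots,\sigma_t$, Level $k$ consists of the entries of the longest initial segment of $\sigma_{t+1},\dots,\sigma_n$ forming an antichain of $P$. All Level 1 entries are essential; an entry $x$ of Level $k\ge 2$ is essential if $x>_P y$ for some $y$ of Level $k-1$. An entry $x$ of Level $k$ is a $P$-left-to-right maximum if it is essential and, in the subsequence (in the order of $\sigma$) of essential entries of Level $k$, $x$ is larger (as an integer) than all essential Level $k$ entries preceding it. ${\sf LRmax}_P(\sigma)$ is the number of $P$-left-to-right maxima of $\sigma$.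
   Formalization: The condition that a flat X meets the cone K_P is stated with points having rational instead of real coordinates (equivalent, by replacing coordinates with their ranks); flats of the braid arrangement are encoded as set partitions of [n]. -}

module Defs where

open import Data.Bool using (Bool; true; false; T; not; _∧_; _∨_; if_then_else_)
open import Data.Nat using (ℕ; zero; suc; _+_; _∸_; _≤ᵇ_; _≡ᵇ_; _<_)
open import Data.Fin using (Fin; toℕ)
open import Data.Fin.Properties using (_≟_)
open import Data.List using (List; []; _∷_; [_]; _++_; map; concatMap; allFin; filterᵇ; length)
open import Data.Bool.ListAction using (all; any)
open import Data.Nat.ListAction using (sum)
open import Data.Vec using (Vec; lookup) renaming ([] to []ᵥ; _∷_ to _∷ᵥ_)
open import Data.Integer using (ℤ; ∣_∣) renaming (_+_ to _+ℤ_; -_ to -ℤ_; +_ to +ℤ_)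
open import Data.Product using (Σ; _×_; ∃)
open import Data.Sum using (_⊎_)
open import Data.Rational using (ℚ) renaming (_<_ to _<ℚ_)
open import Relation.Nullary using (¬_; Dec)
open import Relation.Nullary.Decidable using (⌊_⌋)
open import Relation.Binary.PropositionalEquality using (_≡_)
open import Relation.Binary.Construct.Closure.Transitive using (TransClosure)

-- A poset on [n] = Fin n (element i of Fin n stands for i+1; the
-- integer order on [n] is the order of toℕ).  P is given by its strict
-- order, as a Boolean relation that is irreflexive and transitive;
-- i ≤_P j means i ≡ j or i <_P j.

record Poset (n : ℕ) : Set where
  field
    lt      : Fin n → Fin n → Bool
    irrefl  : ∀ i → lt i i ≡ false
    trans   : ∀ {i j k} → T (lt i j) → T (lt j k) → T (lt i k)

open Poset public

_==_ : ∀ {n} → Fin n → Fin n → Bool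
i == j = ⌊ i ≟ j ⌋

allP : ∀ {n} → (Fin n → Bool) → Bool
allP {n} p = all p (allFin n)

countᵇ : ∀ {A : Set} → (A → Bool) → List A → ℕ
countᵇ p xs = length (filterᵇ p xs)

allVecs : ∀ n m → List (Vec (Fin n) m)
allVecs n zero    = []ᵥ ∷ []
allVecs n (suc m) = concatMap (λ x → map (x ∷ᵥ_) (allVecs n m)) (allFin n)

-- Permutations of [n] in one-line notation  σ = [σ_1, …, σ_n],
-- σ_i = lookup σ i; τ as a map sends i to lookup τ i.

isPerm : ∀ {n} → Vec (Fin n) n → Bool
isPerm σ = allP (λ p → allP (λ q → not (lookup σ p == lookup σ q) ∨ (p == q)))

isLinExt : ∀ {n} → Poset n → Vec (Fin n) n → Bool
isLinExt P σ = allP (λ p → allP (λ q →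
  not (lt P (lookup σ p) (lookup σ q)) ∨ (suc (toℕ p) ≤ᵇ toℕ q)))

LinExt : ∀ {n} → Poset n → Set
LinExt {n} P = Σ (Vec (Fin n) n) (λ σ → T (isPerm σ) × T (isLinExt P σ))

iter : ∀ {n} → Vec (Fin n) n → ℕ → Fin n → Fin n
iter τ zero    i = i
iter τ (suc k) i = lookup τ (iter τ k i)

-- the orbit of i: τ^0 i, …, τ^(n-1) i (a cycle has length ≤ n)
orbit : ∀ {n} → Vec (Fin n) n → Fin n → List (Fin n)
orbit {n} τ i = map (λ k → iter τ (toℕ k) i) (allFin n)

sameCycleᵇ : ∀ {n} → Vec (Fin n) n → Fin n → Fin n → Bool
sameCycleᵇ τ i j = any (λ x → x == j) (orbit τ i)

SameCycle : ∀ {n} → Vec (Fin n) n → Fin n → Fin n → Set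
SameCycle τ i j = T (sameCycleᵇ τ i j)

-- cyc(τ): number of cycles = number of elements that are the smallest
-- element of their cycle
cyc : ∀ {n} → Vec (Fin n) n → ℕ
cyc {n} τ = countᵇ (λ i → all (λ x → toℕ i ≤ᵇ toℕ x) (orbit τ i)) (allFin n)

-- P-transverse partitions (here: the cycle partition of τ).
-- Blocks are named by any of their elements; "B ≤ B'" in P/π holds iff
-- p ≤_P q for some p ∈ B, q ∈ B'.

QuotLe : ∀ {n} → Poset n → Vec (Fin n) n → Fin n → Fin n → Set
QuotLe P τ i j = ∃ λ p → ∃ λ q →
  SameCycle τ i p × SameCycle τ j q × (p ≡ q ⊎ T (lt P p q))

IsPTransverseCycles : ∀ {n} → Poset n → Vec (Fin n) n → Set
IsPTransverseCycles P τ =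
  (∀ i j → SameCycle τ i j → ¬ T (lt P i j))
  ×
  -- P/π (transitive closure of QuotLe, reflexive automatically) is
  -- antisymmetric, i.e. a poset
  (∀ i j → TransClosure (QuotLe P τ) i j → TransClosure (QuotLe P τ) j i
         → SameCycle τ i j)

STransverse : ∀ {n} → Poset n → Set
STransverse {n} P =
  Σ (Vec (Fin n) n) (λ τ → T (isPerm τ) × IsPTransverseCycles P τ)

comparable : ∀ {n} → Poset n → Fin n → Fin n → Bool
comparable P x y = lt P x y ∨ lt P y x

levelsGo : ∀ {n} → Poset n → List (Fin n) → List (Fin n) → List (List (Fin n))
levelsGo P cur []       = cur ∷ []
levelsGo P cur (x ∷ xs) =
  if any (comparable P x) cur
  then cur ∷ levelsGo P (x ∷ []) xs
  else levelsGo P (cur ++ (x ∷ [])) xs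

levels : ∀ {n} → Poset n → List (Fin n) → List (List (Fin n))
levels P σ = levelsGo P [] σ

-- number of left-to-right maxima (integer order) of a word; m = 1 + max so far
lrCountGo : ∀ {n} → ℕ → List (Fin n) → ℕ
lrCountGo m []       = 0
lrCountGo m (x ∷ xs) =
  if m ≤ᵇ toℕ x then suc (lrCountGo (suc (toℕ x)) xs) else lrCountGo m xs

lrCount : ∀ {n} → List (Fin n) → ℕ
lrCount w = lrCountGo 0 w

-- levels k ≥ 2: essential entries are those >_P some entry of level k-1
lrLater : ∀ {n} → Poset n → List (Fin n) → List (List (Fin n)) → ℕ
lrLater P prev []       = 0
lrLater P prev (L ∷ Ls) =
  lrCount (filterᵇ (λ x → any (λ y → lt P y x) prev) L) + lrLater P L Ls

LRmaxFromLevels : ∀ {n} → Poset n → List (List (Fin n)) → ℕ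
LRmaxFromLevels P []        = 0
LRmaxFromLevels P (L1 ∷ Ls) = lrCount L1 + lrLater P L1 Ls   -- level 1: all essential

toList : ∀ {n m} → Vec (Fin n) m → List (Fin n)
toList []ᵥ       = []
toList (x ∷ᵥ xs) = x ∷ toList xs

LRmax : ∀ {n} → Poset n → Vec (Fin n) n → ℕ
LRmax P σ = LRmaxFromLevels P (levels P (toList σ))

-- Intersection lattice of the braid arrangement.
-- A flat X ∈ 𝓛 is encoded by the set partition of [n] it determines
-- (X = {x : x_i = x_j whenever i, j lie in a common block}); a set
-- partition is encoded canonically by the vector lab with
-- lab i = smallest element of the block of i.

isCanon : ∀ {n} → Vec (Fin n) n → Bool
isCanon lab = allP (λ i → (lookup lab (lookup lab i) == lookup lab i)
                          ∧ (toℕ (lookup lab i) ≤ᵇ toℕ i))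

Flat : ℕ → Set
Flat n = Σ (Vec (Fin n) n) (λ lab → T (isCanon lab))

flats : ∀ n → List (Vec (Fin n) n)
flats n = filterᵇ isCanon (allVecs n n)

sameBlock : ∀ {n} → Vec (Fin n) n → Fin n → Fin n → Bool
sameBlock lab i j = lookup lab i == lookup lab j

-- Y ≤ X in 𝓛 (reverse inclusion: X ⊆ Y)
leFlat : ∀ {n} → Vec (Fin n) n → Vec (Fin n) n → Bool
leFlat Y X = allP (λ i → allP (λ j → not (sameBlock Y i j) ∨ sameBlock X i j))

eqFlat : ∀ {n} → Vec (Fin n) n → Vec (Fin n) n → Bool
eqFlat Y X = allP (λ i → lookup Y i == lookup X i)

-- V itself: the partition into singletons
isV : ∀ {n} → Vec (Fin n) n → Bool
isV X = allP (λ i → lookup X i == i)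

-- codim X = n - (number of blocks)
codim : ∀ {n} → Vec (Fin n) n → ℕ
codim {n} X = n ∸ countᵇ (λ i → lookup X i == i) (allFin n)

-- Möbius function μ(V, X) by its defining recursion
-- μ(V,V) = 1,  μ(V,X) = - Σ_{V ≤ Y < X} μ(V,Y); the fuel argument bounds
-- the length of chains (n+1 suffices).
μFuel : ∀ {n} → ℕ → Vec (Fin n) n → ℤ
μFuel         zero    X = +ℤ 0
μFuel {n} (suc f) X =
  if isV X then +ℤ 1
  else -ℤ (sumℤ (map (μFuel f)
             (filterᵇ (λ Y → leFlat Y X ∧ not (eqFlat Y X)) (flats n))))
  where
  sumℤ : List ℤ → ℤ
  sumℤ []       = +ℤ 0
  sumℤ (z ∷ zs) = z +ℤ sumℤ zs

μV : ∀ {n} → Vec (Fin n) n → ℤ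
μV {n} X = μFuel (suc n) X

-- the open polyhedral cone K_P meets the flat X
-- (points taken with rational coordinates)
Meets : ∀ {n} → Poset n → Vec (Fin n) n → Set
Meets {n} P X = ∃ λ (x : Fin n → ℚ) →
  (∀ i j → T (sameBlock X i j) → x i ≡ x j) ×
  (∀ i j → T (lt P i j) → x i <ℚ x j)

-- c_k(P) = Σ_{X ∈ 𝓛^int(K_P), codim X = k} |μ(V,X)|,
-- computed with any decision procedure for Meets
cCoeff : ∀ {n} (P : Poset n) → (∀ X → Dec (Meets P X)) → ℕ → ℕ
cCoeff {n} P d k =
  sum (map (λ X → if ⌊ d X ⌋ ∧ (codim X ≡ᵇ k) then ∣ μV X ∣ else 0) (flats n))

-- coefficient of t^k in Σ_{σ ∈ L(P)} t^(n - LRmax_P σ)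
linExtCoeff : ∀ {n} (P : Poset n) → ℕ → ℕ
linExtCoeff {n} P k =
  countᵇ (λ σ → isPerm σ ∧ isLinExt P σ ∧ ((n ∸ LRmax P σ) ≡ᵇ k)) (allVecs n n)

{-# OPTIONS --safe #-}
module Submission where

-- A P-transverse permutation τ is written as a word by listing its cycles: the
-- level of a cycle is its height in the quotient poset P/π, each cycle starts
-- with its leader (the largest of its essential elements: all of them on the
-- lowest level, elsewhere those lying above an element one level lower), and
-- cycles are sorted by level, then by leader.
-- For an antichain this is Foata's fundamental transformation.  Reading the word
-- from left to right recovers levels and leaders, because the leaders are exactly
-- the P-left-to-right maxima.
--
-- For the Poincaré polynomial, |μ(V,X)| is the number of permutations with cycle
-- partition X: the sums of signs over these permutations satisfy the recursion
-- of μ, since multiplying by a transposition of two elements in one block of X is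
-- a sign-reversing involution.  Finally X meets the cone iff X is P-transverse,
-- heights in P/π serving as coordinates.

open import Defs hiding (trans)
open import Algebra.Structures using (IsCommutativeMonoid)
open import Data.Bool using (Bool; true; false; T; not; _∧_; _∨_; if_then_else_; T?)
open import Data.Bool.ListAction using (all; any)
open import Data.Bool.Properties using (T-∧; T-∨; T-≡; T-not-≡)
open import Data.Empty using (⊥-elim)
open import Data.Fin using (Fin; toℕ; fromℕ<; zero; suc)
open import Data.Fin.Properties using (toℕ-injective; toℕ<n; pigeonhole; toℕ-fromℕ<) renaming (_≟_ to _≟ᶠ_; any? to anyᶠ?)
open import Data.Integer using (ℤ; ∣_∣; 0ℤ; 1ℤ; -[1+_]) renaming (+_ to toℤ; _+_ to _+ℤ_; -_ to -ℤ_; _*_ to _*ℤ_)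
import Data.Integer as ℤ
import Data.Integer.Properties as ℤₚ
open import Data.List using (List; []; _∷_; [_]; _++_; map; allFin; filterᵇ; length)
open import Data.List.Membership.Propositional using (_∈_; _∉_; find; lose)
open import Data.List.Membership.Propositional.Properties
  using (∈-allFin; ∈-filter⁺; ∈-filter⁻; ∈-∃++; ∈-++⁺ˡ; ∈-++⁺ʳ; ∈-++⁻; ∈-map⁺; ∈-map⁻; ∈-AllPairs₂; ∈-concatMap⁺)
open import Data.List.Properties using (length-++; length-tabulate; length-filter; filter-all; ++-identityʳ; ++-assoc)
open import Data.List.Relation.Binary.Permutation.Propositional
  using (_↭_; prep; swap; ↭-refl; ↭-trans; ↭-sym; ↭⇒↭ₛ)
open import Data.List.Relation.Binary.Permutation.Propositional.Properties using (↭-length)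
open import Data.List.Relation.Binary.Permutation.Setoid.Properties using (Unique-resp-↭)
open import Data.List.Relation.Unary.All as All using (All; []; _∷_)
open import Data.List.Relation.Unary.All.Properties using (all⁺; all⁻) renaming (map⁺ to All-map⁺)
open import Data.List.Relation.Unary.AllPairs as AllPairs using (AllPairs; []; _∷_)
open import Data.List.Relation.Unary.AllPairs.Properties using () renaming (map⁺ to AllPairs-map⁺; map⁻ to AllPairs-map⁻)
open import Data.List.Relation.Unary.Any as Any using (here; there)
open import Data.List.Relation.Unary.Any.Properties using (any⁺; any⁻)
open import Data.List.Relation.Unary.Linked as Linked using (Linked; [-]; _∷_)
open import Data.List.Relation.Unary.Linked.Properties using (Linked⇒AllPairs)
open import Data.List.Relation.Unary.Unique.Propositional using (Unique)
open import Data.List.Relation.Unary.Unique.Propositional.Properties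
  using (allFin⁺) renaming (filter⁺ to Unique-filter⁺; map⁺ to Unique-map⁺; concat⁺ to Unique-concat⁺)
import Data.List.Sort as Sort
open import Data.Nat
open import Data.Nat.Coprimality using (1-coprimeTo) renaming (sym to coprime-sym)
open import Data.Nat.DivMod using (_%_; _/_; m≡m%n+[m/n]*n; m%n<n)
open import Data.Nat.ListAction using (sum)
open import Data.Nat.Properties
open import Data.Product using (Σ; _×_; ∃; ∃₂; _,_; proj₁; proj₂)
open import Data.Rational using (ℚ; mkℚ; *<*) renaming (_<_ to _<ℚ_)
import Data.Rational.Properties as ℚₚ
open import Data.Sum using (_⊎_; inj₁; inj₂)
open import Data.Unit using (⊤; tt)
open import Data.Vec using (Vec; lookup; tabulate) renaming ([] to []ᵥ; _∷_ to _∷ᵥ_)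
open import Data.Vec.Functional using (updateAt)
open import Data.Vec.Functional.Properties using (updateAt-updates; updateAt-minimal)
open import Data.Vec.Properties using (lookup∘tabulate; tabulate∘lookup; tabulate-cong)
open import Function using (_∘_; id; const; case_of_)
open import Function.Bundles using (Equivalence)
open import Relation.Binary.Construct.Closure.Transitive
  using (TransClosure) renaming ([_] to [_]⁺; _∷_ to _∷⁺_; _++_ to _++⁺_)
import Relation.Binary.Construct.On as On
open import Relation.Binary.Definitions using (tri<; tri≈; tri>)
open import Relation.Binary.PropositionalEquality hiding ([_])
open import Relation.Nullary using (¬_; Dec; yes; no; contradiction)
open import Relation.Nullary.Decidable using (⌊_⌋; toWitness; fromWitness; _×-dec_; _⊎-dec_; ¬?)
open Equivalence using (to; from)

-- The word splits at the right places because every cycle contains an essential element: the top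
-- step of a longest chain below it in `P/π` ends at one. A cycle of positive level can therefore
-- start with a letter lying above the previous level, and this is what makes the greedy
-- decomposition of the word change level there and not later; letters of equal height are
-- incomparable and never force a change too early. A large non-essential letter in front could be
-- swallowed by the previous level, which is why such letters must not compete for leadership. The
-- correspondence is handled as a relation `SortedBy` between permutations and words instead of a
-- pair of inverse functions. A layout is determined by its permutation, and the reading of a word
-- by the word, so the relation is functional in both directions; the bijectivity of `Φ` and the
-- equality of coefficients both follow from that.

private variable
  A B : Set
  n m : ℕ

-- Boolean reflection and counting by injections

T-allP⁻ : {p : Fin n → Bool} → T (allP p) → ∀ i → T (p i)
T-allP⁻ {p = p} t i = All.lookup (all⁺ p (allFin _) t) (∈-allFin i)

T-allP⁺ : {p : Fin n → Bool} → (∀ i → T (p i)) → T (allP p)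
T-allP⁺ {p = p} h = all⁻ p (All.universal h (allFin _))

T-==⁻ : {i j : Fin n} → T (i == j) → i ≡ j
T-==⁻ {i = i} {j} = toWitness {a? = i ≟ᶠ j}

T-==⁺ : {i j : Fin n} → i ≡ j → T (i == j)
T-==⁺ {i = i} {j} = fromWitness {a? = i ≟ᶠ j}

T-⇒⁻ : ∀ {a b} → T (not a ∨ b) → T a → T b
T-⇒⁻ {true} t _ = t

T-⇒⁺ : ∀ {a b} → (T a → T b) → T (not a ∨ b)
T-⇒⁺ {true}  f = f tt
T-⇒⁺ {false} f = tt

T-¬⇒≡false : ∀ {b} → ¬ T b → b ≡ false
T-¬⇒≡false {true}  ¬t = contradiction tt ¬t
T-¬⇒≡false {false} ¬t = refl

T-⇔⇒≡ : ∀ {a b} → (T a → T b) → (T b → T a) → a ≡ b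
T-⇔⇒≡ {true}  {true}  f g = refl
T-⇔⇒≡ {true}  {false} f g = ⊥-elim (f tt)
T-⇔⇒≡ {false} {true}  f g = ⊥-elim (g tt)
T-⇔⇒≡ {false} {false} f g = refl

-- Each step deletes the partner of the head from `ys`. A relation in place of a function lets the
-- partner be chosen from a membership proof, without extending the choice to the whole type.
injection⇒length-≤ : {xs : List A} {ys : List B} (R : A → B → Set) →
  (∀ {x x′ y} → R x y → R x′ y → x ≡ x′) →
  Unique xs → (∀ {x} → x ∈ xs → ∃ λ y → y ∈ ys × R x y) → length xs ≤ length ys
injection⇒length-≤ R inj [] f = z≤n
injection⇒length-≤ {xs = x ∷ xs} R inj (x∉ ∷ u) f with f (here refl)
... | y , y∈ , r with ∈-∃++ y∈
... | as , bs , refl = begin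
  suc (length xs)                ≤⟨ s≤s (injection⇒length-≤ R inj u g) ⟩
  suc (length (as ++ bs))        ≡⟨ cong suc (length-++ as) ⟩
  suc (length as + length bs)    ≡⟨ sym (+-suc (length as) (length bs)) ⟩
  length as + length (y ∷ bs)    ≡⟨ sym (length-++ as) ⟩
  length (as ++ y ∷ bs)          ∎
  where
  open ≤-Reasoning
  g : ∀ {x′} → x′ ∈ xs → ∃ λ y′ → y′ ∈ as ++ bs × R x′ y′
  g x′∈ with f (there x′∈)
  ... | y′ , y′∈ , r′ with ∈-++⁻ as y′∈
  ... | inj₁ ∈as         = y′ , ∈-++⁺ˡ ∈as , r′
  ... | inj₂ (here refl) = contradiction (inj r r′) (All.lookup x∉ x′∈)
  ... | inj₂ (there ∈bs) = y′ , ∈-++⁺ʳ as ∈bs , r′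

∈-filterᵇ⁺ : {p : A → Bool} {x : A} {xs : List A} → x ∈ xs → T (p x) → x ∈ filterᵇ p xs
∈-filterᵇ⁺ {p = p} = ∈-filter⁺ (T? ∘ p)

∈-filterᵇ⁻ : {p : A → Bool} {x : A} (xs : List A) → x ∈ filterᵇ p xs → x ∈ xs × T (p x)
∈-filterᵇ⁻ {p = p} xs = ∈-filter⁻ (T? ∘ p) {xs = xs}

filterᵇ-unique : (p : A → Bool) {xs : List A} → Unique xs → Unique (filterᵇ p xs)
filterᵇ-unique p = Unique-filter⁺ (T? ∘ p)

countᵇ-≤ : {p : A → Bool} {q : B → Bool} {xs : List A} {ys : List B} (R : A → B → Set) →
  (∀ {x x′ y} → R x y → R x′ y → x ≡ x′) → Unique xs →
  (∀ {x} → x ∈ xs → T (p x) → ∃ λ y → y ∈ ys × T (q y) × R x y) →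
  countᵇ p xs ≤ countᵇ q ys
countᵇ-≤ {p = p} {q} {xs} {ys} R inj u f = injection⇒length-≤ R inj (filterᵇ-unique p u) g
  where
  g : ∀ {x} → x ∈ filterᵇ p xs → ∃ λ y → y ∈ filterᵇ q ys × R x y
  g x∈ with ∈-filterᵇ⁻ xs x∈
  ... | x∈xs , px with f x∈xs px
  ... | y , y∈ , qy , r = y , ∈-filterᵇ⁺ y∈ qy , r

countᵇ-cong : {p q : A → Bool} → (∀ x → p x ≡ q x) → ∀ xs → countᵇ p xs ≡ countᵇ q xs
countᵇ-cong eq [] = refl
countᵇ-cong {p = p} {q} eq (x ∷ xs) rewrite eq x with q x
... | true  = cong suc (countᵇ-cong eq xs)
... | false = countᵇ-cong eq xs

countᵇ-accept : {p : A → Bool} {x : A} (xs : List A) → T (p x) → countᵇ p (x ∷ xs) ≡ suc (countᵇ p xs)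
countᵇ-accept xs t rewrite to T-≡ t = refl

countᵇ-reject : {p : A → Bool} {x : A} (xs : List A) → ¬ T (p x) → countᵇ p (x ∷ xs) ≡ countᵇ p xs
countᵇ-reject xs ¬t rewrite T-¬⇒≡false ¬t = refl

length-allFin : ∀ n → length (allFin n) ≡ n
length-allFin n = length-tabulate {n = n} id

unique⇒length≤ : {xs : List (Fin n)} → Unique xs → length xs ≤ n
unique⇒length≤ {n} {xs} u = subst (length xs ≤_) (length-allFin n)
  (injection⇒length-≤ _≡_ (λ { refl refl → refl }) u (λ {x} _ → x , ∈-allFin x , refl))

unique⇒complete : {xs : List (Fin n)} → Unique xs → length xs ≡ n → ∀ z → z ∈ xs
unique⇒complete {n} {xs} u len z with Any.any? (z ≟ᶠ_) xs
... | yes z∈ = z∈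
... | no  z∉ = contradiction
  (subst (λ l → suc l ≤ n) len (unique⇒length≤ (All.tabulate (λ y∈ z≡y → z∉ (subst (_∈ xs) (sym z≡y) y∈)) ∷ u)))
  1+n≰n

-- Words as vectors and as lists

toList-length : (v : Vec (Fin n) m) → length (toList v) ≡ m
toList-length []ᵥ       = refl
toList-length (x ∷ᵥ xs) = cong suc (toList-length xs)

∈-toList : (v : Vec (Fin n) m) (p : Fin m) → lookup v p ∈ toList v
∈-toList (x ∷ᵥ xs) zero    = here refl
∈-toList (x ∷ᵥ xs) (suc p) = there (∈-toList xs p)

∈-toList⁻ : (v : Vec (Fin n) m) {x : Fin n} → x ∈ toList v → ∃ λ p → lookup v p ≡ x
∈-toList⁻ (x ∷ᵥ v) (here refl) = zero , refl
∈-toList⁻ (x ∷ᵥ v) (there x∈) with ∈-toList⁻ v x∈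
... | p , eq = suc p , eq

fromList : (xs : List (Fin n)) → length xs ≡ m → Vec (Fin n) m
fromList []       refl = []ᵥ
fromList (x ∷ xs) refl = x ∷ᵥ fromList xs refl

toList-fromList : (xs : List (Fin n)) (eq : length xs ≡ m) → toList (fromList xs eq) ≡ xs
toList-fromList []       refl = refl
toList-fromList (x ∷ xs) refl = cong (x ∷_) (toList-fromList xs refl)

toList-injective : (u v : Vec (Fin n) m) → toList u ≡ toList v → u ≡ v
toList-injective []ᵥ []ᵥ refl = refl
toList-injective (x ∷ᵥ u) (y ∷ᵥ v) eq with toList u in equ | toList v in eqv
toList-injective (x ∷ᵥ u) (.x ∷ᵥ v) refl | _ | _ = cong (x ∷ᵥ_) (toList-injective u v (trans equ (sym eqv)))

AllPairs-toList⁺ : {R : Fin n → Fin n → Set} (v : Vec (Fin n) m) →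
  (∀ p q → toℕ p < toℕ q → R (lookup v p) (lookup v q)) → AllPairs R (toList v)
AllPairs-toList⁺ []ᵥ h = []
AllPairs-toList⁺ {R = R} (x ∷ᵥ v) h =
  All.tabulate (λ y∈ → let p , eq = ∈-toList⁻ v y∈ in subst (R x) eq (h zero (suc p) z<s)) ∷
  AllPairs-toList⁺ v (λ p q p<q → h (suc p) (suc q) (s<s p<q))

AllPairs-toList⁻ : {R : Fin n → Fin n → Set} (v : Vec (Fin n) m) → AllPairs R (toList v) →
  ∀ p q → toℕ p < toℕ q → R (lookup v p) (lookup v q)
AllPairs-toList⁻ (x ∷ᵥ v) (rs ∷ _) zero    (suc q) _         = All.lookup rs (∈-toList v q)
AllPairs-toList⁻ (x ∷ᵥ v) (_ ∷ r)  (suc p) (suc q) (s<s p<q) = AllPairs-toList⁻ v r p q p<q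

Injectiveᵛ : Vec (Fin n) m → Set
Injectiveᵛ v = ∀ {p q} → lookup v p ≡ lookup v q → p ≡ q

isPerm⁻ : (σ : Vec (Fin n) n) → T (isPerm σ) → Injectiveᵛ σ
isPerm⁻ σ t {p} {q} eq = T-==⁻ (T-⇒⁻ (T-allP⁻ (T-allP⁻ t p) q) (T-==⁺ eq))

isPerm⁺ : (σ : Vec (Fin n) n) → Injectiveᵛ σ → T (isPerm σ)
isPerm⁺ σ inj = T-allP⁺ λ p → T-allP⁺ λ q →
  T-⇒⁺ {lookup σ p == lookup σ q} (λ t → T-==⁺ (inj (T-==⁻ t)))

Injectiveᵛ⇒Unique : (σ : Vec (Fin n) m) → Injectiveᵛ σ → Unique (toList σ)
Injectiveᵛ⇒Unique σ inj = AllPairs-toList⁺ σ (λ p q p<q eq → <⇒≢ p<q (cong toℕ (inj eq)))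

Unique⇒Injectiveᵛ : (σ : Vec (Fin n) m) → Unique (toList σ) → Injectiveᵛ σ
Unique⇒Injectiveᵛ σ u {p} {q} eq with <-cmp (toℕ p) (toℕ q)
... | tri< p<q _ _ = contradiction eq (AllPairs-toList⁻ σ u p q p<q)
... | tri≈ _ p≡q _ = toℕ-injective p≡q
... | tri> _ _ q<p = contradiction (sym eq) (AllPairs-toList⁻ σ u q p q<p)

∈-toList-perm : (σ : Vec (Fin n) n) → Injectiveᵛ σ → ∀ z → z ∈ toList σ
∈-toList-perm σ inj = unique⇒complete (Injectiveᵛ⇒Unique σ inj) (toList-length σ)

isLinExt⁻ : (P : Poset n) (σ : Vec (Fin n) n) → T (isLinExt P σ) →
  AllPairs (λ x y → ¬ T (lt P y x)) (toList σ)
isLinExt⁻ P σ t = AllPairs-toList⁺ σ λ p q p<q y<x →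
  <-asym p<q (≤ᵇ⇒≤ _ _ (T-⇒⁻ (T-allP⁻ (T-allP⁻ t q) p) y<x))

isLinExt⁺ : (P : Poset n) (σ : Vec (Fin n) n) →
  AllPairs (λ x y → ¬ T (lt P y x)) (toList σ) → T (isLinExt P σ)
isLinExt⁺ P σ h = T-allP⁺ λ p → T-allP⁺ λ q → T-⇒⁺ (λ t → ≤⇒≤ᵇ (aux p q t))
  where
  aux : ∀ p q → T (lt P (lookup σ p) (lookup σ q)) → toℕ p < toℕ q
  aux p q t with <-cmp (toℕ p) (toℕ q)
  ... | tri< p<q _ _ = p<q
  ... | tri≈ _ p≡q _ with refl ← toℕ-injective p≡q = ⊥-elim (subst T (irrefl P _) t)
  ... | tri> _ _ q<p = contradiction t (AllPairs-toList⁻ σ h q p q<p)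

least : {Q : ℕ → Set} → (∀ k → Dec (Q k)) → ∀ k → Q k → ∃ λ j → j ≤ k × Q j × (∀ l → l < j → ¬ Q l)
least Q? zero q = zero , z≤n , q , λ _ ()
least {Q} Q? (suc k) q with Q? 0
... | yes q₀ = 0 , z≤n , q₀ , λ _ ()
... | no ¬q₀ with least (Q? ∘ suc) k q
... | j , j≤k , qj , min = suc j , s≤s j≤k , qj , λ { zero _ → ¬q₀ ; (suc l) (s<s l<j) → min l l<j }

-- Only some drop of `Q` is found. In the applications `Q` is downward closed, so the drop is its
-- maximum.
last-before : {Q : ℕ → Set} → (∀ k → Dec (Q k)) → Q 0 → ∀ b → ¬ Q b → ∃ λ k → Q k × ¬ Q (suc k)
last-before Q? q₀ zero ¬q = contradiction q₀ ¬q
last-before Q? q₀ (suc b) ¬q with Q? b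
... | yes q = b , q , ¬q
... | no ¬q′ = last-before Q? q₀ b ¬q′

-- Cycles of a permutation

module Perm {n : ℕ} (τ : Vec (Fin n) n) (τ-injective : Injectiveᵛ τ) where

  Reach : Fin n → Fin n → Set
  Reach i j = ∃ λ k → iter τ k i ≡ j

  iter-+ : ∀ k l i → iter τ (k + l) i ≡ iter τ k (iter τ l i)
  iter-+ zero    l i = refl
  iter-+ (suc k) l i = cong (lookup τ) (iter-+ k l i)

  iter-injective : ∀ k {i j} → iter τ k i ≡ iter τ k j → i ≡ j
  iter-injective zero    eq = eq
  iter-injective (suc k) eq = iter-injective k (τ-injective eq)

  abstract
    -- Two of the `n + 1` iterates with exponents 0 to `n` agree, and the smaller power cancels by
    -- injectivity. The form `suc d` with `d < n` gives a nonzero modulus that is at most `n`.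
    period : ∀ i → ∃ λ d → d < n × iter τ (suc d) i ≡ i
    period i with pigeonhole (n<1+n n) (λ k → iter τ (toℕ k) i)
    ... | a , b , a<b , eq with m≤n⇒∃[o]m+o≡n a<b
    ... | d , a+d≡b = d ,
      ≤-trans (≤-trans (s≤s (m≤n+m d (toℕ a))) (≤-reflexive a+d≡b)) (≤-pred (toℕ<n b)) ,
      sym (iter-injective (toℕ a) (trans eq (trans (cong (λ k → iter τ k i) (trans (sym a+d≡b) (sym (+-suc (toℕ a) d))))
        (iter-+ (toℕ a) (suc d) i))))

  iter-* : ∀ {d i} → iter τ d i ≡ i → ∀ q → iter τ (q * d) i ≡ i
  iter-* eq zero    = refl
  iter-* {d} {i} eq (suc q) = trans (iter-+ d (q * d) i) (trans (cong (iter τ d) (iter-* eq q)) eq)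

  -- The exponent is reduced modulo the period. The bound is needed because `orbit` lists only `n`
  -- iterates.
  Reach-bounded : ∀ {i j} → Reach i j → ∃ λ k → k < n × iter τ k i ≡ j
  Reach-bounded {i} (k , eq) with period i
  ... | d , d<n , per = k % suc d , <-≤-trans (m%n<n k (suc d)) d<n ,
    trans (sym (trans (cong (λ l → iter τ l i) (m≡m%n+[m/n]*n k (suc d)))
      (trans (iter-+ (k % suc d) _ i) (cong (iter τ (k % suc d)) (iter-* {suc d} per (k / suc d)))))) eq

  Reach-refl : ∀ {i} → Reach i i
  Reach-refl = 0 , refl

  Reach-trans : ∀ {i j k} → Reach i j → Reach j k → Reach i k
  Reach-trans {i} (k , refl) (l , refl) = l + k , iter-+ l k i

  Reach-sym : ∀ {i j} → Reach i j → Reach j i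
  Reach-sym {i} (k , refl) with period i
  -- After the first `k` steps, `k * d` further ones complete `k` periods of length `suc d`.
  ... | d , _ , per = k * d , trans (sym (iter-+ (k * d) k i))
    (trans (cong (λ l → iter τ l i) (trans (+-comm (k * d) k) (sym (*-suc k d)))) (iter-* {suc d} per k))

  Reach-step : ∀ {i} → Reach i (lookup τ i)
  Reach-step = 1 , refl

  preimage : ∀ i → ∃ λ j → lookup τ j ≡ i
  preimage i with period i
  ... | d , _ , per = iter τ d i , per

  Reach-invariant : {f : Fin n → A} → (∀ i → f (lookup τ i) ≡ f i) → ∀ {i j} → Reach i j → f i ≡ f j
  Reach-invariant inv (zero  , refl) = refl
  Reach-invariant inv (suc k , refl) = trans (Reach-invariant inv (k , refl)) (sym (inv _))

  SameCycle⇒Reach : ∀ {i j} → SameCycle τ i j → Reach i j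
  SameCycle⇒Reach {i} {j} t with find (any⁻ _ (orbit τ i) t)
  ... | x , x∈ , x==j with ∈-map⁻ _ x∈
  ... | k , _ , refl = toℕ k , T-==⁻ x==j

  Reach⇒SameCycle : ∀ {i j} → Reach i j → SameCycle τ i j
  Reach⇒SameCycle {i} {j} r with Reach-bounded r
  ... | k , k<n , eq = any⁺ _ (lose (∈-map⁺ (λ l → iter τ (toℕ l) i) (∈-allFin (fromℕ< k<n)))
    (T-==⁺ (trans (cong (λ l → iter τ l i) (toℕ-fromℕ< k<n)) eq)))

  Reach? : ∀ i j → Dec (Reach i j)
  Reach? i j with T? (sameCycleᵇ τ i j)
  ... | yes t = yes (SameCycle⇒Reach t)
  ... | no ¬t = no (¬t ∘ Reach⇒SameCycle)

  isCycleMin : Fin n → Bool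
  isCycleMin i = all (λ x → toℕ i ≤ᵇ toℕ x) (orbit τ i)

  isCycleMin⁻ : ∀ {i} → T (isCycleMin i) → ∀ {j} → Reach i j → toℕ i ≤ toℕ j
  isCycleMin⁻ {i} t {j} r with find (any⁻ _ (orbit τ i) (Reach⇒SameCycle r))
  ... | x , x∈ , x==j with T-==⁻ {i = x} x==j
  ... | refl = ≤ᵇ⇒≤ _ _ (All.lookup (all⁺ _ (orbit τ i) t) x∈)

  isCycleMin⁺ : ∀ {i} → (∀ {j} → Reach i j → toℕ i ≤ toℕ j) → T (isCycleMin i)
  isCycleMin⁺ {i} h = all⁻ (λ x → toℕ i ≤ᵇ toℕ x) {xs = orbit τ i}
    (All.tabulate λ x∈ → case ∈-map⁻ (λ k → iter τ (toℕ k) i) x∈ of λ { (k , _ , refl) → ≤⇒≤ᵇ (h (toℕ k , refl)) })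

lex-< : ∀ {N a a′ b b′} → a < a′ → b < N → a * N + b < a′ * N + b′
lex-< {N} {a} {a′} {b} {b′} a<a′ b<N = begin-strict
  a * N + b   <⟨ +-monoʳ-< (a * N) b<N ⟩
  a * N + N   ≡⟨ +-comm (a * N) N ⟩
  suc a * N   ≤⟨ *-monoˡ-≤ N a<a′ ⟩
  a′ * N      ≤⟨ m≤m+n (a′ * N) b′ ⟩
  a′ * N + b′ ∎
  where open ≤-Reasoning

-- Words and cycles

module Foata {n : ℕ} (P : Poset n) where

  infix 4 _≺_
  _≺_ : Fin n → Fin n → Set
  x ≺ y = T (lt P x y)

  ≺-irrefl : ∀ {x} → ¬ (x ≺ x)
  ≺-irrefl {x} = subst T (irrefl P x)

  Essential : (Fin n → ℕ) → Fin n → Set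
  Essential lev x = lev x ≡ 0 ⊎ ∃ λ p → p ≺ x × lev x ≡ suc (lev p)

  -- lev is the height of the cycle in P/π; lead is the first letter of the cycle
  -- in the word, its largest essential element.
  record Layout (τ : Vec (Fin n) n) : Set where
    field
      lev            : Fin n → ℕ
      lead           : Fin n → Fin n
      lev-τ          : ∀ i → lev (lookup τ i) ≡ lev i
      lev-≺          : ∀ {x y} → x ≺ y → lev x < lev y
      lead-τ         : ∀ i → lead (lookup τ i) ≡ lead i
      lead-reach     : ∀ i → ∃ λ k → iter τ k (lead i) ≡ i
      lead-essential : ∀ i → Essential lev (lead i)
      lead-max       : ∀ i → Essential lev i → toℕ i ≤ toℕ (lead i)

  module Key {τ : Vec (Fin n) n} (inj : Injectiveᵛ τ) (D : Layout τ) where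
    open Perm τ inj
    open Layout D public

    lev-lead : ∀ i → lev (lead i) ≡ lev i
    lev-lead i = Reach-invariant lev-τ (lead-reach i)

    lead-idem : ∀ i → lead (lead i) ≡ lead i
    lead-idem i = Reach-invariant lead-τ (lead-reach i)

    private abstract
      first-visit : ∀ i → ∃ λ j → j < n × iter τ j (lead i) ≡ i × (∀ l → l < j → iter τ l (lead i) ≢ i)
      first-visit i with Reach-bounded (lead-reach i)
      ... | k , k<n , eq with least (λ l → iter τ l (lead i) ≟ᶠ i) k eq
      ... | j , j≤k , eqj , min = j , ≤-<-trans j≤k k<n , eqj , min

    pos : Fin n → ℕ
    pos i = proj₁ (first-visit i)

    pos<n : ∀ i → pos i < n
    pos<n i = proj₁ (proj₂ (first-visit i))

    iter-pos : ∀ i → iter τ (pos i) (lead i) ≡ i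
    iter-pos i = proj₁ (proj₂ (proj₂ (first-visit i)))

    pos-min : ∀ i l → l < pos i → iter τ l (lead i) ≢ i
    pos-min i = proj₂ (proj₂ (proj₂ (first-visit i)))

    pos-unique : ∀ i j → iter τ j (lead i) ≡ i → (∀ l → l < j → iter τ l (lead i) ≢ i) → pos i ≡ j
    pos-unique i j eq min with <-cmp (pos i) j
    ... | tri< lt _ _ = contradiction (iter-pos i) (min _ lt)
    ... | tri≈ _ eq′ _ = eq′
    ... | tri> _ _ gt = contradiction eq (pos-min i _ gt)

    -- A visit to `lookup τ i` at an earlier time `suc l` would pull back by injectivity to a visit
    -- to `i` at time `l`, before its first; a visit at time 0 would make it the leader.
    pos-τ : ∀ i → lookup τ i ≢ lead i → pos (lookup τ i) ≡ suc (pos i)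
    pos-τ i ne = pos-unique (lookup τ i) (suc (pos i))
      (subst (λ l → iter τ (suc (pos i)) l ≡ lookup τ i) (sym (lead-τ i)) (cong (lookup τ) (iter-pos i)))
      λ { zero    _         eq → ne (trans (sym eq) (lead-τ i))
        ; (suc l) (s<s l<p) eq → pos-min i l l<p
            (trans (cong (iter τ l) (sym (lead-τ i))) (τ-inj eq)) }
      where
      τ-inj : ∀ {x y} → lookup τ x ≡ lookup τ y → x ≡ y
      τ-inj = inj

    -- Level, leader and position in the cycle as digits to base `n`. The last two are below `n`, so
    -- comparing keys is comparing lexicographically.
    key : Fin n → ℕ
    key i = (lev i * n + toℕ (lead i)) * n + pos i

    key-lev : ∀ {x y} → lev x < lev y → key x < key y
    key-lev {x} l = lex-< (lex-< l (toℕ<n (lead x))) (pos<n x)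

    key-lead : ∀ {x y} → lev x ≡ lev y → toℕ (lead x) < toℕ (lead y) → key x < key y
    key-lead {x} {y} eq l = lex-< (subst (λ k → lev x * n + toℕ (lead x) < k * n + toℕ (lead y)) eq
      (+-monoʳ-< (lev x * n) l)) (pos<n x)

    key-τ : ∀ i → lookup τ i ≢ lead i → key (lookup τ i) ≡ suc (key i)
    key-τ i ne = trans (cong₂ _+_ (cong₂ (λ a b → (a * n + toℕ b) * n) (lev-τ i) (lead-τ i)) (pos-τ i ne)) (+-suc _ _)

    key-leader : ∀ {x y} → lead x ≡ x → lead y ≡ x → key x ≤ key y
    key-leader {x} {y} lx ly = subst (_≤ key y) (sym key-x) (+-monoʳ-≤ _ (z≤n {pos y}))
      where
      lev≡ : lev x ≡ lev y
      lev≡ = trans (cong lev (sym ly)) (lev-lead y)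
      key-x : key x ≡ (lev y * n + toℕ (lead y)) * n + 0
      key-x = cong₂ _+_ (cong₂ (λ a b → (a * n + toℕ b) * n) lev≡ (trans lx (sym ly)))
        (pos-unique x 0 lx (λ _ ()))

    key⇒lev≤ : ∀ {x y} → key x ≤ key y → lev x ≤ lev y
    key⇒lev≤ le = ≮⇒≥ (λ l → <⇒≱ (key-lev l) le)

    key⇒lead≤ : ∀ {x y} → key x ≤ key y → lev x ≡ lev y → toℕ (lead x) ≤ toℕ (lead y)
    key⇒lead≤ le eq = ≮⇒≥ (λ l → <⇒≱ (key-lead (sym eq) l) le)

    key-injective : ∀ {x y} → key x ≡ key y → x ≡ y
    key-injective {x} {y} eq = trans (sym (iter-pos x)) (trans (cong₂ (iter τ) pos≡ lead≡) (iter-pos y))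
      where
      lev≡ : lev x ≡ lev y
      lev≡ = ≤-antisym (key⇒lev≤ (≤-reflexive eq)) (key⇒lev≤ (≤-reflexive (sym eq)))
      lead≡ : lead x ≡ lead y
      lead≡ = toℕ-injective (≤-antisym (key⇒lead≤ (≤-reflexive eq) lev≡)
        (key⇒lead≤ (≤-reflexive (sym eq)) (sym lev≡)))
      pos≡ : pos x ≡ pos y
      pos≡ = +-cancelˡ-≡ ((lev x * n + toℕ (lead x)) * n) _ _
        (trans eq (cong₂ (λ a b → (a * n + toℕ b) * n + pos y) (sym lev≡) (sym lead≡)))

  module _ {τ : Vec (Fin n) n} (inj : Injectiveᵛ τ) where
    open Perm τ inj

    -- In `D` the leader of `i` lies above some `p` exactly one level lower; by induction `D′` puts
    -- `p` at least as high, and going up from `p` to the leader costs one more level in `D′`. By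
    -- symmetry the levels of a layout depend on `τ` alone.
    lev-minimal : (D D′ : Layout τ) → ∀ k i → Layout.lev D i ≡ k → k ≤ Layout.lev D′ i
    lev-minimal D D′ zero    i eq = z≤n
    lev-minimal D D′ (suc k) i eq with Layout.lead-essential D i
    ... | inj₁ z = contradiction (trans (sym z) (trans (Key.lev-lead inj D i) eq)) (λ ())
    ... | inj₂ (p , p≺l , eq′) = ≤-trans
      (s≤s (lev-minimal D D′ k p (suc-injective (trans (sym eq′) (trans (Key.lev-lead inj D i) eq)))))
      (≤-trans (Layout.lev-≺ D′ p≺l)
        (≤-reflexive (Reach-invariant (Layout.lev-τ D′) (Layout.lead-reach D i))))

    lev-unique : (D D′ : Layout τ) → ∀ i → Layout.lev D i ≡ Layout.lev D′ i
    lev-unique D D′ i = ≤-antisym (lev-minimal D D′ _ i refl) (lev-minimal D′ D _ i refl)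

    Essential-cong : ∀ {f g : Fin n → ℕ} → (∀ i → f i ≡ g i) → ∀ {i} → Essential f i → Essential g i
    Essential-cong eq (inj₁ z)            = inj₁ (trans (sym (eq _)) z)
    Essential-cong eq (inj₂ (p , lt , s)) = inj₂ (p , lt , trans (sym (eq _)) (trans s (cong suc (eq p))))

    lead-minimal : (D D′ : Layout τ) → ∀ i → toℕ (Layout.lead D i) ≤ toℕ (Layout.lead D′ i)
    lead-minimal D D′ i = subst (λ l → toℕ (Layout.lead D i) ≤ toℕ l)
      (Reach-invariant (Layout.lead-τ D′) (Layout.lead-reach D i))
      (Layout.lead-max D′ _ (Essential-cong (lev-unique D D′) (Layout.lead-essential D i)))

    lead-unique : (D D′ : Layout τ) → ∀ i → Layout.lead D i ≡ Layout.lead D′ i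
    lead-unique D D′ i = toℕ-injective (≤-antisym (lead-minimal D D′ i) (lead-minimal D′ D i))

    -- All layouts of `τ` sort the letters alike, so a word sorted by one is sorted by every other.
    key-unique : (inj′ : Injectiveᵛ τ) (D D′ : Layout τ) → ∀ i → Key.key inj D i ≡ Key.key inj′ D′ i
    key-unique inj′ D D′ i = cong₂ (λ a b → a * n + b)
      (cong₂ (λ a b → a * n + toℕ b) (lev-unique D D′ i) (lead-unique D D′ i))
      (Key.pos-unique inj D i (Key.pos inj′ D′ i)
        (subst (λ l → iter τ (Key.pos inj′ D′ i) l ≡ i) (sym (lead-unique D D′ i)) (Key.iter-pos inj′ D′ i))
        (λ l l< eq → Key.pos-min inj′ D′ i l l< (subst (λ s → iter τ l s ≡ i) (lead-unique D D′ i) eq)))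

  -- One pass over a word: e tells which entries of the current level k are
  -- essential, cur is the part of that level already read, s is its last
  -- left-to-right maximum and p the letter just read.  The permutation t cuts
  -- the word into cycles before each left-to-right maximum.
  data Scan (lev : Fin n → ℕ) (lead t : Fin n → Fin n) :
    (Fin n → Bool) → List (Fin n) → ℕ → Fin n → Fin n → List (Fin n) → Set where
    done : ∀ {e cur k s p} → t p ≡ s → Scan lev lead t e cur k s p []
    new  : ∀ {e cur k s p x w} → T (any (comparable P x) cur) →
           t p ≡ s → lev x ≡ suc k → lead x ≡ x →
           Scan lev lead t (λ z → any (λ y → lt P y z) cur) [ x ] (suc k) x x w →
           Scan lev lead t e cur k s p (x ∷ w)
    cut  : ∀ {e cur k s p x w} → ¬ T (any (comparable P x) cur) → T (e x) → toℕ s < toℕ x →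
           t p ≡ s → lev x ≡ k → lead x ≡ x →
           Scan lev lead t e (cur ++ [ x ]) k x x w →
           Scan lev lead t e cur k s p (x ∷ w)
    stay : ∀ {e cur k s p x w} → ¬ T (any (comparable P x) cur) → ¬ (T (e x) × toℕ s < toℕ x) → x ≢ s →
           t p ≡ x → lev x ≡ k → lead x ≡ s →
           Scan lev lead t e (cur ++ [ x ]) k s x w →
           Scan lev lead t e cur k s p (x ∷ w)

  -- Ties the test `e`, which sees only the part already read, to `Essential`, which speaks of
  -- entire levels. By `cover`, once only higher levels are unread, `cur` contains all of level `k`.
  record Inv (lev : Fin n → ℕ) (e : Fin n → Bool) (cur : List (Fin n)) (k : ℕ) (w : List (Fin n)) : Set where
    field
      cur-lev     : ∀ {z} → z ∈ cur → lev z ≡ k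
      cover       : ∀ z → lev z < k ⊎ z ∈ cur ⊎ z ∈ w
      e⇒essential : ∀ {z} → lev z ≡ k → T (e z) → Essential lev z
      essential⇒e : ∀ {z} → lev z ≡ k → Essential lev z → T (e z)

  module _ {lev : Fin n → ℕ} where
    open Inv

    Inv-start : ∀ {x w} → (∀ z → z ∈ x ∷ w) → lev x ≡ 0 → Inv lev (λ _ → true) [ x ] 0 w
    Inv-start all x₀ .cur-lev (here refl) = x₀
    Inv-start all x₀ .cover z with all z
    ... | here refl = inj₂ (inj₁ (here refl))
    ... | there z∈  = inj₂ (inj₂ z∈)
    Inv-start all x₀ .e⇒essential eq _ = inj₁ eq
    Inv-start all x₀ .essential⇒e _ _ = tt

    Inv-new : ∀ {e cur k x w} → Inv lev e cur k (x ∷ w) → (∀ {y} → y ∈ x ∷ w → k < lev y) → lev x ≡ suc k →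
      Inv lev (λ z → any (λ y → lt P y z) cur) [ x ] (suc k) w
    Inv-new I above x₊ .cur-lev (here refl) = x₊
    Inv-new I above x₊ .cover z with cover I z
    ... | inj₁ l                  = inj₁ (m<n⇒m<1+n l)
    ... | inj₂ (inj₁ z∈)          = inj₁ (s≤s (≤-reflexive (cur-lev I z∈)))
    ... | inj₂ (inj₂ (here refl)) = inj₂ (inj₁ (here refl))
    ... | inj₂ (inj₂ (there z∈))  = inj₂ (inj₂ z∈)
    Inv-new {cur = cur} I above x₊ .e⇒essential eq t with find (any⁻ _ cur t)
    ... | y , y∈ , y≺z = inj₂ (y , y≺z , trans eq (cong suc (sym (cur-lev I y∈))))
    Inv-new I above x₊ .essential⇒e eq (inj₁ z₀) = contradiction (trans (sym z₀) eq) (λ ())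
    -- Here `p` has level `k`, so it is neither below that level nor among the unread letters, and
    -- must be in `cur`.
    Inv-new I above x₊ .essential⇒e eq (inj₂ (p , p≺z , eq′)) with cover I p | suc-injective (trans (sym eq′) eq)
    ... | inj₁ l         | refl = contradiction refl (<⇒≢ l)
    ... | inj₂ (inj₁ p∈) | _    = any⁺ _ (lose p∈ p≺z)
    ... | inj₂ (inj₂ p∈) | refl = contradiction refl (<⇒≢ (above p∈))

    Inv-same : ∀ {e cur k x w} → Inv lev e cur k (x ∷ w) → lev x ≡ k → Inv lev e (cur ++ [ x ]) k w
    Inv-same {cur = cur} I xk .cur-lev z∈ with ∈-++⁻ cur z∈
    ... | inj₁ z∈′         = cur-lev I z∈′
    ... | inj₂ (here refl) = xk
    Inv-same {cur = cur} I xk .cover z with cover I z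
    ... | inj₁ l                  = inj₁ l
    ... | inj₂ (inj₁ z∈)          = inj₂ (inj₁ (∈-++⁺ˡ z∈))
    ... | inj₂ (inj₂ (here refl)) = inj₂ (inj₁ (∈-++⁺ʳ cur (here refl)))
    ... | inj₂ (inj₂ (there z∈))  = inj₂ (inj₂ z∈)
    Inv-same I xk .e⇒essential = e⇒essential I
    Inv-same I xk .essential⇒e = essential⇒e I

  comparable⁻ : ∀ {x y} → T (comparable P x y) → x ≺ y ⊎ y ≺ x
  comparable⁻ = to T-∨

  module _ {τ : Vec (Fin n) n} (inj : Injectiveᵛ τ) (D : Layout τ) where
    open Perm τ inj
    open Key inj D
    open Inv

    private
      level-antichain : ∀ {e cur k w x} → Inv lev e cur k w → lev x ≡ k → ¬ T (any (comparable P x) cur)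
      level-antichain {cur = cur} I xk t with find (any⁻ _ cur t)
      ... | y , y∈ , c with comparable⁻ c
      ... | inj₁ x≺y = <⇒≢ (lev-≺ x≺y) (trans xk (sym (cur-lev I y∈)))
      ... | inj₂ y≺x = <⇒≢ (lev-≺ y≺x) (trans (cur-lev I y∈) (sym xk))

    -- Inside a cycle, successive letters have successive keys, so a sorted word lists each cycle
    -- without gaps and passes to a leader only after the previous cycle has closed. A leader on the
    -- same level exceeds the last leader and gives `cut`; one on a higher level lies above a letter
    -- of `cur` and gives `new`.
    sorted⇒Scan : ∀ {e cur k s p} w → Inv lev e cur k w →
      AllPairs (λ x y → key x < key y) (p ∷ w) → (∀ z → z ∈ w ⊎ key z ≤ key p) →
      lead p ≡ s → lev p ≡ k → Scan lev lead (lookup τ) e cur k s p w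
    sorted⇒Scan {s = s} {p} [] I srt seen refl pk with lookup τ p ≟ᶠ lead p
    ... | yes eq = done eq
    ... | no ne with seen (lookup τ p)
    ...   | inj₂ le = contradiction (≤-trans (≤-reflexive (sym (key-τ p ne))) le) 1+n≰n
    sorted⇒Scan {e} {cur} {k} {s} {p} (x ∷ w) I ((p<x ∷ p<w) ∷ (x<w ∷ srt)) seen refl refl
      with lead x ≟ᶠ x
    ... | no ne = stay (level-antichain I lev-x) small x≢s τp lev-x lead-x
                   (sorted⇒Scan w (Inv-same I lev-x) (x<w ∷ srt) seen′ lead-x lev-x)
      where
      z = proj₁ (preimage x)
      τz : lookup τ z ≡ x
      τz = proj₂ (preimage x)
      key-x : key x ≡ suc (key z)
      key-x = trans (cong key (sym τz)) (key-τ z (λ eq → ne (trans (cong lead (sym τz))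
        (trans (lead-τ z) (trans (sym eq) τz)))))
      seen′ : ∀ z → z ∈ w ⊎ key z ≤ key x
      seen′ z with seen z
      ... | inj₂ le          = inj₂ (≤-trans le (<⇒≤ p<x))
      ... | inj₁ (here refl) = inj₂ ≤-refl
      ... | inj₁ (there z∈)  = inj₁ z∈
      z≤p : key z ≤ key p
      z≤p with seen z
      ... | inj₂ le          = le
      ... | inj₁ (here eq)   = contradiction (subst (λ y → key y ≡ suc (key z)) (sym eq) key-x) (<⇒≢ (n<1+n _))
      ... | inj₁ (there z∈)  = contradiction (<-trans (All.lookup x<w z∈) (subst (key z <_) (sym key-x) (n<1+n _))) (n≮n _)
      -- The key of `z` is one below that of `x` and at most that of `p`, which is itself below that
      -- of `x`.
      z≡p : z ≡ p
      z≡p = key-injective (≤-antisym z≤p (≤-pred (≤-trans p<x (≤-reflexive key-x))))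
      τp : lookup τ p ≡ x
      τp = trans (cong (lookup τ) (sym z≡p)) τz
      lev-x : lev x ≡ lev p
      lev-x = trans (cong lev (sym τp)) (lev-τ p)
      lead-x : lead x ≡ lead p
      lead-x = trans (cong lead (sym τp)) (lead-τ p)
      x≢s : x ≢ lead p
      x≢s eq = ne (trans lead-x (sym eq))
      small : ¬ (T (e x) × toℕ (lead p) < toℕ x)
      small (ex , l) = <⇒≱ l (subst (λ y → toℕ x ≤ toℕ y) lead-x (lead-max x (e⇒essential I lev-x ex)))
    ... | yes lead-x = start (m≤n⇒m<n∨m≡n (key⇒lev≤ (<⇒≤ p<x)))
      where
      seen′ : ∀ z → z ∈ w ⊎ key z ≤ key x
      seen′ z with seen z
      ... | inj₂ le          = inj₂ (≤-trans le (<⇒≤ p<x))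
      ... | inj₁ (here refl) = inj₂ ≤-refl
      ... | inj₁ (there z∈)  = inj₁ z∈
      first : ∀ {y} → y ∈ x ∷ w → key x ≤ key y
      first (here refl) = ≤-refl
      first (there y∈)  = <⇒≤ (All.lookup x<w y∈)
      -- If the cycle of `p` went on, `lookup τ p` would carry the key following that of `p` and be
      -- unread, hence be `x`; being its own leader, `x` would then be `lead p` after all.
      τp : lookup τ p ≡ lead p
      τp with lookup τ p ≟ᶠ lead p
      ... | yes eq = eq
      ... | no ne with seen (lookup τ p)
      ...   | inj₂ le = contradiction (≤-trans (≤-reflexive (sym (key-τ p ne))) le) 1+n≰n
      ...   | inj₁ z∈ = contradiction (trans τp≡x (trans (sym lead-x) (trans (cong lead (sym τp≡x)) (lead-τ p)))) ne
        where
        τp≡x : lookup τ p ≡ x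
        τp≡x = key-injective (≤-antisym (≤-trans (≤-reflexive (key-τ p ne)) p<x) (first z∈))
      start : lev p < lev x ⊎ lev p ≡ lev x → Scan lev lead (lookup τ) e cur (lev p) (lead p) p (x ∷ w)
      start (inj₂ eq) = cut (level-antichain I (sym eq))
        (essential⇒e I (sym eq) (subst (Essential lev) lead-x (lead-essential x)))
        (subst (λ y → toℕ (lead p) < toℕ y) lead-x
          (≤∧≢⇒< (key⇒lead≤ (<⇒≤ p<x) eq) λ same → <⇒≱ p<x (key-leader lead-x (trans (toℕ-injective same) lead-x))))
        τp (sym eq) lead-x (sorted⇒Scan w (Inv-same I (sym eq)) (x<w ∷ srt) seen′ lead-x (sym eq))
      start (inj₁ l) with subst (Essential lev) lead-x (lead-essential x)
      ... | inj₁ x₀ = contradiction (subst (lev p <_) x₀ l) λ ()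
      ... | inj₂ (q , q≺x , eq) = new (any⁺ _ (lose q∈ (from T-∨ (inj₂ q≺x)))) τp lev-x lead-x
              (sorted⇒Scan w (Inv-new I above lev-x) (x<w ∷ srt) seen′ lead-x lev-x)
        where
        above : ∀ {y} → y ∈ x ∷ w → lev p < lev y
        above y∈ = <-≤-trans l (key⇒lev≤ (first y∈))
        q≥p : lev p ≤ lev q
        q≥p = ≤-pred (subst (lev p <_) eq l)
        -- The letter `q` under `x` is not below the current level, and it is not unread since its
        -- key is smaller than that of `x`. So it is in `cur`, and no level is skipped.
        q∈ : q ∈ cur
        q∈ with cover I q
        ... | inj₁ l′        = contradiction q≥p (<⇒≱ l′)
        ... | inj₂ (inj₁ q∈) = q∈
        ... | inj₂ (inj₂ q∈) = contradiction (key⇒lev≤ (first q∈)) (<⇒≱ (lev-≺ q≺x))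
        lev-x : lev x ≡ suc (lev p)
        lev-x = trans eq (cong suc (cur-lev I q∈))

-- Reading a word: cycles, levels and left-to-right maxima

module FoataScan {n : ℕ} (P : Poset n) where
  open Foata P

  essentialOver : List (Fin n) → Fin n → Bool
  essentialOver cur z = any (λ y → lt P y z) cur

  module _ {lev lev′ : Fin n → ℕ} {lead lead′ t t′ : Fin n → Fin n} where

    Scan-cong : ∀ {e cur k s p w} → (∀ {y} → y ∈ w → lev y ≡ lev′ y × lead y ≡ lead′ y) →
      (∀ {y} → y ∈ p ∷ w → t y ≡ t′ y) →
      Scan lev lead t e cur k s p w → Scan lev′ lead′ t′ e cur k s p w
    Scan-cong f g (done tp) = done (trans (sym (g (here refl))) tp)
    Scan-cong f g (new c tp vx lx sc) = new c (trans (sym (g (here refl))) tp)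
      (trans (sym (proj₁ (f (here refl)))) vx) (trans (sym (proj₂ (f (here refl)))) lx)
      (Scan-cong (f ∘ there) (g ∘ there) sc)
    Scan-cong f g (cut c e l tp vx lx sc) = cut c e l (trans (sym (g (here refl))) tp)
      (trans (sym (proj₁ (f (here refl)))) vx) (trans (sym (proj₂ (f (here refl)))) lx)
      (Scan-cong (f ∘ there) (g ∘ there) sc)
    Scan-cong f g (stay c e l tp vx lx sc) = stay c e l (trans (sym (g (here refl))) tp)
      (trans (sym (proj₁ (f (here refl)))) vx) (trans (sym (proj₂ (f (here refl)))) lx)
      (Scan-cong (f ∘ there) (g ∘ there) sc)

    -- The conditions that decide between `new`, `cut` and `stay` exclude each other and involve
    -- only the word and the state, not `lev`, `lead` or `t`. Two scans of one word thus take the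
    -- same branches, and each branch prescribes `t p`.
    Scan-functional : ∀ {e cur k s p w} → Scan lev lead t e cur k s p w → Scan lev′ lead′ t′ e cur k s p w →
      ∀ {y} → y ∈ p ∷ w → t y ≡ t′ y
    Scan-functional (done tp) (done tp′) (here refl) = trans tp (sym tp′)
    Scan-functional (new _ tp _ _ _) (new _ tp′ _ _ _) (here refl) = trans tp (sym tp′)
    Scan-functional (new _ _ _ _ sc) (new _ _ _ _ sc′) (there y∈) = Scan-functional sc sc′ y∈
    Scan-functional (new c _ _ _ _) (cut ¬c _ _ _ _ _ _) _ = contradiction c ¬c
    Scan-functional (new c _ _ _ _) (stay ¬c _ _ _ _ _ _) _ = contradiction c ¬c
    Scan-functional (cut ¬c _ _ _ _ _ _) (new c _ _ _ _) _ = contradiction c ¬c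
    Scan-functional (stay ¬c _ _ _ _ _ _) (new c _ _ _ _) _ = contradiction c ¬c
    Scan-functional (cut _ e l _ _ _ _) (stay _ ¬el _ _ _ _ _) _ = contradiction (e , l) ¬el
    Scan-functional (stay _ ¬el _ _ _ _ _) (cut _ e l _ _ _ _) _ = contradiction (e , l) ¬el
    Scan-functional (cut _ _ _ tp _ _ _) (cut _ _ _ tp′ _ _ _) (here refl) = trans tp (sym tp′)
    Scan-functional (cut _ _ _ _ _ _ sc) (cut _ _ _ _ _ _ sc′) (there y∈) = Scan-functional sc sc′ y∈
    Scan-functional (stay _ _ _ tp _ _ _) (stay _ _ _ tp′ _ _ _) (here refl) = trans tp (sym tp′)
    Scan-functional (stay _ _ _ _ _ _ sc) (stay _ _ _ _ _ _ sc′) (there y∈) = Scan-functional sc sc′ y∈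

  Scannable : (Fin n → Bool) → List (Fin n) → ℕ → Fin n → Fin n → List (Fin n) → Set
  Scannable e cur k s p w = ∃ λ lev → ∃₂ λ lead t → Scan lev lead t e cur k s p w

  private
    set : {C : Set} → Fin n → C → (Fin n → C) → Fin n → C
    set i c f = updateAt f i (const c)

    -- The tables are filled from the end of the word backwards. As letters do not repeat,
    -- overwriting one entry leaves the scan of the rest intact.
    extend : ∀ {e cur k s x w} p vx lx tp → Unique (p ∷ x ∷ w) → Scannable e cur k s x w →
      ∃ λ lev → ∃₂ λ lead t → lev x ≡ vx × lead x ≡ lx × t p ≡ tp × Scan lev lead t e cur k s x w
    extend {x = x} p vx lx tp (p∉ ∷ x∉ ∷ _) (lev , lead , t , sc) =
      set x vx lev , set x lx lead , set p tp t ,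
      updateAt-updates x lev , updateAt-updates x lead , updateAt-updates p t ,
      Scan-cong (λ y∈ → let y≢x = λ y≡x → All.lookup x∉ y∈ (sym y≡x) in
                  sym (updateAt-minimal _ x lev y≢x) , sym (updateAt-minimal _ x lead y≢x))
                (λ y∈ → sym (updateAt-minimal _ p t (λ y≡p → All.lookup p∉ y∈ (sym y≡p)))) sc

  Scan-exists : ∀ {e cur k s p} w → Unique (p ∷ w) → s ∉ w → Scannable e cur k s p w
  -- Constant tables are enough here: `t p ≡ s` is the only equation of `done`, and the entries for
  -- earlier letters are overwritten on the way back.
  Scan-exists {s = s} [] u s∉ = (λ _ → 0) , (λ _ → s) , (λ _ → s) , done refl
  Scan-exists {e} {cur} {k} {s} {p} (x ∷ w) u@(_ ∷ u′@(x∉ ∷ _)) s∉ with T? (any (comparable P x) cur)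
  ... | yes c with extend p (suc k) x s u (Scan-exists w u′ λ x∈ → All.lookup x∉ x∈ refl)
  ...   | lev , lead , t , vx , lx , tp , sc = lev , lead , t , new c tp vx lx sc
  Scan-exists {e} {cur} {k} {s} {p} (x ∷ w) u@(_ ∷ u′@(x∉ ∷ _)) s∉ | no ¬c with T? (e x) | suc (toℕ s) ≤? toℕ x
  ... | yes ex | yes l with extend p k x s u (Scan-exists w u′ λ x∈ → All.lookup x∉ x∈ refl)
  ...   | lev , lead , t , vx , lx , tp , sc = lev , lead , t , cut ¬c ex l tp vx lx sc
  Scan-exists {e} {cur} {k} {s} {p} (x ∷ w) u@(_ ∷ u′@(x∉ ∷ _)) s∉ | no ¬c | yes ex | no ¬l
    with extend p k s x u (Scan-exists w u′ (s∉ ∘ there))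
  ...   | lev , lead , t , vx , lx , tp , sc =
    lev , lead , t , stay ¬c (¬l ∘ proj₂) (λ x≡s → s∉ (here (sym x≡s))) tp vx lx sc
  Scan-exists {e} {cur} {k} {s} {p} (x ∷ w) u@(_ ∷ u′@(x∉ ∷ _)) s∉ | no ¬c | no ¬ex | _
    with extend p k s x u (Scan-exists w u′ (s∉ ∘ there))
  ...   | lev , lead , t , vx , lx , tp , sc =
    lev , lead , t , stay ¬c (¬ex ∘ proj₁) (λ x≡s → s∉ (here (sym x≡s))) tp vx lx sc

  record LinearAfter (cur w : List (Fin n)) : Set where
    constructor linearAfter
    field
      after  : ∀ {c y} → c ∈ cur → y ∈ w → ¬ (y ≺ c)
      linear : AllPairs (λ x y → ¬ (y ≺ x)) w
  open LinearAfter

  LinearAfter-new : ∀ {cur x w} → LinearAfter cur (x ∷ w) → LinearAfter [ x ] w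
  LinearAfter-new (linearAfter _ (x< ∷ lin)) = linearAfter (λ { (here refl) → All.lookup x< }) lin

  LinearAfter-same : ∀ {cur x w} → LinearAfter cur (x ∷ w) → LinearAfter (cur ++ [ x ]) w
  LinearAfter-same {cur} (linearAfter aft (x< ∷ lin)) = linearAfter
    (λ c∈ → case ∈-++⁻ cur c∈ of λ { (inj₁ c∈′) y∈ → aft c∈′ (there y∈) ; (inj₂ (here refl)) → All.lookup x< }) lin

  -- A letter that breaks the antichain is comparable to a letter read before it, and in a linear
  -- extension it can only be the larger of the two. Hence each level after the first opens with an
  -- essential letter.
  new-essential : ∀ {cur x w} → LinearAfter cur (x ∷ w) → T (any (comparable P x) cur) → T (essentialOver cur x)
  new-essential {cur} L c with find (any⁻ _ cur c)
  ... | y , y∈ , xy with comparable⁻ xy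
  ... | inj₁ x≺y = contradiction x≺y (after L y∈ (here refl))
  ... | inj₂ y≺x = any⁺ _ (lose y∈ y≺x)

  -- Treats the first level like the others: its test `e` is constantly true.
  levelsTotal : (Fin n → Bool) → List (List (Fin n)) → ℕ
  levelsTotal e []       = 0
  levelsTotal e (L ∷ Ls) = lrCount (filterᵇ e L) + lrLater P L Ls

  lrLater-total : ∀ prev Ls → lrLater P prev Ls ≡ levelsTotal (essentialOver prev) Ls
  lrLater-total prev []       = refl
  lrLater-total prev (L ∷ Ls) = refl

  LRmax-total : ∀ Ls → LRmaxFromLevels P Ls ≡ levelsTotal (λ _ → true) Ls
  LRmax-total []       = refl
  LRmax-total (L ∷ Ls) = cong (λ w → lrCount w + lrLater P L Ls)
    (sym (filter-all (λ _ → T? true) (All.universal (λ _ → tt) L)))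

  module _ {lev : Fin n → ℕ} {lead t : Fin n → Fin n} where

    private
      Above : ℕ → List (Fin n) → Fin n → Set
      Above k cur y = k < lev y ⊎ lev y ≡ k × (∀ {c} → c ∈ cur → ¬ T (comparable P y c))

      Separated : Fin n → Fin n → Set
      Separated x y = lev x < lev y ⊎ lev x ≡ lev y × ¬ T (comparable P y x)

      Above-same : ∀ {k cur x y} → Above k (cur ++ [ x ]) y → Above k cur y
      Above-same (inj₁ l)       = inj₁ l
      Above-same (inj₂ (eq , h)) = inj₂ (eq , h ∘ ∈-++⁺ˡ)

      Above⇒Separated : ∀ {k cur x y} → lev x ≡ k → x ∈ cur → Above k cur y → Separated x y
      Above⇒Separated refl x∈ (inj₁ l)        = inj₁ l
      Above⇒Separated refl x∈ (inj₂ (eq , h)) = inj₂ (sym eq , h x∈)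

      Scan-above : ∀ {e cur k s p w} → Scan lev lead t e cur k s p w → All (Above k cur) w
      Scan-above (done _) = []
      Scan-above (new _ _ vx _ sc) = inj₁ (≤-reflexive (sym vx)) ∷
        All.map (λ { (inj₁ l) → inj₁ (<-trans (n<1+n _) l) ; (inj₂ (eq , _)) → inj₁ (≤-reflexive (sym eq)) }) (Scan-above sc)
      Scan-above (cut ¬c _ _ _ vx _ sc) = inj₂ (vx , λ c∈ c → ¬c (any⁺ _ (lose c∈ c))) ∷ All.map Above-same (Scan-above sc)
      Scan-above (stay ¬c _ _ _ vx _ sc) = inj₂ (vx , λ c∈ c → ¬c (any⁺ _ (lose c∈ c))) ∷ All.map Above-same (Scan-above sc)

      head-separated : ∀ {e cur k s p x w} → lev x ≡ k → x ∈ cur → Scan lev lead t e cur k s p w → All (Separated x) w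
      head-separated vx x∈ sc = All.map (Above⇒Separated vx x∈) (Scan-above sc)

      Scan-separated : ∀ {e cur k s p w} → Scan lev lead t e cur k s p w → AllPairs Separated w
      Scan-separated (done _) = []
      Scan-separated (new _ _ vx _ sc) = head-separated vx (here refl) sc ∷ Scan-separated sc
      Scan-separated {cur = cur} (cut _ _ _ _ vx _ sc) = head-separated vx (∈-++⁺ʳ cur (here refl)) sc ∷ Scan-separated sc
      Scan-separated {cur = cur} (stay _ _ _ _ vx _ sc) = head-separated vx (∈-++⁺ʳ cur (here refl)) sc ∷ Scan-separated sc

    -- Of two letters, the later one is on a higher level or is incomparable on the same level, and
    -- linearity forbids that the larger element come first.
    Scan-lev-≺ : ∀ {e k s p w} → Scan lev lead t e [ p ] k s p w → lev p ≡ k → AllPairs (λ x y → ¬ (y ≺ x)) (p ∷ w) →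
      ∀ {x y} → x ∈ p ∷ w → y ∈ p ∷ w → x ≺ y → lev x < lev y
    Scan-lev-≺ sc vp lin x∈ y∈ x≺y
      with ∈-AllPairs₂ (AllPairs.zip (lin , head-separated vp (here refl) sc ∷ Scan-separated sc)) x∈ y∈
    ... | inj₁ refl                        = contradiction x≺y ≺-irrefl
    ... | inj₂ (inj₁ (_ , inj₁ l))         = l
    ... | inj₂ (inj₁ (_ , inj₂ (_ , ¬c)))  = contradiction (from T-∨ (inj₂ x≺y)) ¬c
    ... | inj₂ (inj₂ (¬x≺y , _))           = contradiction x≺y ¬x≺y

    private
      GoodLead : Fin n → Set
      GoodLead x = Essential lev (lead x) × (Essential lev x → toℕ x ≤ toℕ (lead x))

      own-lead : ∀ {x} → lead x ≡ x → Essential lev x → GoodLead x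
      own-lead {x} lx ess = subst (Essential lev) (sym lx) ess , λ _ → ≤-reflexive (cong toℕ (sym lx))

    -- A leader is essential because it opens a level or has passed the test `e`. A letter that
    -- stays in the cycle either fails the test or does not exceed the leader `s`.
    Scan-lead : ∀ {e cur k s p w} → Scan lev lead t e cur k s p w → Inv lev e cur k w → LinearAfter cur w →
      Essential lev s → All GoodLead w
    Scan-lead (done _) I L es = []
    Scan-lead (new c _ vx lx sc) I L es = own-lead lx ex ∷ Scan-lead sc I′ (LinearAfter-new L) ex
      where
      I′ = Inv-new I (λ { (here refl) → ≤-reflexive (sym vx)
                        ; (there y∈) → case All.lookup (Scan-above sc) y∈ of λ
                            { (inj₁ l) → <-trans (n<1+n _) l ; (inj₂ (eq , _)) → ≤-reflexive (sym eq) } }) vx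
      ex = Inv.e⇒essential I′ vx (new-essential L c)
    Scan-lead (cut _ ex _ _ vx lx sc) I L es = own-lead lx ess ∷ Scan-lead sc (Inv-same I vx) (LinearAfter-same L) ess
      where ess = Inv.e⇒essential I vx ex
    Scan-lead {s = s} (stay _ ¬el _ _ vx lx sc) I L es =
      (subst (Essential lev) (sym lx) es ,
       λ ex → subst (λ l → _ ≤ toℕ l) (sym lx) (≮⇒≥ λ l → ¬el (Inv.essential⇒e I vx ex , l))) ∷
      Scan-lead sc (Inv-same I vx) (LinearAfter-same L) es

    Scan-invariant : ∀ {e cur k s p w} → Scan lev lead t e cur k s p w → lead p ≡ s → lead s ≡ s → lev p ≡ k → lev s ≡ k →
      All (λ x → lead (t x) ≡ lead x × lev (t x) ≡ lev x) (p ∷ w)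
    Scan-invariant (done refl) lp ls vp vs = (trans ls (sym lp) , trans vs (sym vp)) ∷ []
    Scan-invariant (new _ refl vx lx sc) lp ls vp vs = (trans ls (sym lp) , trans vs (sym vp)) ∷ Scan-invariant sc lx lx vx vx
    Scan-invariant (cut _ _ _ refl vx lx sc) lp ls vp vs = (trans ls (sym lp) , trans vs (sym vp)) ∷ Scan-invariant sc lx lx vx vx
    Scan-invariant (stay _ _ _ refl vx lx sc) lp ls vp vs = (trans lx (sym lp) , trans vx (sym vp)) ∷ Scan-invariant sc lx ls vx vs

    -- The leader `s` of the open cycle still awaits its preimage and so stands on the right in
    -- place of `p`. At the start of a word both are the first letter, and `t` permutes the letters.
    Scan-permutes : ∀ {e cur k s p w} → Scan lev lead t e cur k s p w → map t (p ∷ w) ↭ s ∷ w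
    Scan-permutes (done refl) = ↭-refl
    Scan-permutes (new _ refl _ _ sc) = prep _ (Scan-permutes sc)
    Scan-permutes (cut _ _ _ refl _ _ sc) = prep _ (Scan-permutes sc)
    Scan-permutes (stay _ _ _ refl _ _ sc) = ↭-trans (prep _ (Scan-permutes sc)) (swap _ _ ↭-refl)

    -- The increase of the key from one letter to the next, spelled out without `key`, which
    -- requires that `t` be already known to be injective with a layout.
    Next : Fin n → Fin n → Set
    Next x y = lev x < lev y ⊎ lev x ≡ lev y × (toℕ (lead x) < toℕ (lead y) ⊎ lead x ≡ lead y × t x ≡ y × y ≢ lead x)

    Scan-linked : ∀ {e cur k s p w} → Scan lev lead t e cur k s p w → lead p ≡ s → lev p ≡ k → Linked Next (p ∷ w)
    Scan-linked (done _) _ _ = [-]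
    Scan-linked (new _ _ vx lx sc) lp refl = inj₁ (≤-reflexive (sym vx)) ∷ Scan-linked sc lx vx
    Scan-linked (cut _ _ l _ vx lx sc) refl vp =
      inj₂ (trans vp (sym vx) , inj₁ (subst (λ y → _ < toℕ y) (sym lx) l)) ∷ Scan-linked sc lx vx
    Scan-linked (stay _ _ ne tp vx lx sc) refl vp =
      inj₂ (trans vp (sym vx) , inj₂ (sym lx , tp , ne)) ∷ Scan-linked sc lx vx

    isLead : Fin n → Bool
    isLead x = lead x == x

    -- `lrCount` is applied to completed levels. The hypothesis, for every continuation `u`, records
    -- its state after `cur`: `c` maxima so far, the last of them `s`.
    Scan-count : ∀ {e cur k s p w} → Scan lev lead t e cur k s p w → LinearAfter cur w → ∀ c →
      (∀ u → lrCount (filterᵇ e (cur ++ u)) ≡ c + lrCountGo (suc (toℕ s)) (filterᵇ e u)) →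
      levelsTotal e (levelsGo P cur w) ≡ c + countᵇ isLead w
    Scan-count {e} {cur} (done _) L c h = trans (+-identityʳ _) (trans (cong (lrCount ∘ filterᵇ e) (sym (++-identityʳ cur))) (h []))
    Scan-count {e} {cur} {w = x ∷ w} (new any _ _ lx sc) L c h
      rewrite to T-≡ any | lrLater-total cur (levelsGo P [ x ] w)
            | countᵇ-accept {p = isLead} w (T-==⁺ lx) = cong₂ _+_
        (trans (cong (lrCount ∘ filterᵇ e) (sym (++-identityʳ cur))) (trans (h []) (+-identityʳ c)))
        (Scan-count sc (LinearAfter-new L) 1 first)
      where
      -- The opening letter is essential and hence the first maximum of its level, so the count
      -- restarts at 1.
      first : ∀ u → lrCount (filterᵇ (essentialOver cur) (x ∷ u)) ≡ 1 + lrCountGo (suc (toℕ x)) (filterᵇ (essentialOver cur) u)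
      first u rewrite to T-≡ (new-essential L any) = refl
    Scan-count {e} {cur} {s = s} {w = x ∷ w} (cut ¬any ex l _ _ lx sc) L c h
      rewrite T-¬⇒≡false ¬any | countᵇ-accept {p = isLead} w (T-==⁺ lx) =
        trans (Scan-count sc (LinearAfter-same L) (suc c) step) (sym (+-suc c _))
      where
      step : ∀ u → lrCount (filterᵇ e ((cur ++ [ x ]) ++ u)) ≡ suc c + lrCountGo (suc (toℕ x)) (filterᵇ e u)
      step u rewrite ++-assoc cur [ x ] u | h (x ∷ u) | to T-≡ ex | to T-≡ (≤⇒≤ᵇ l) = +-suc c _
    Scan-count {e} {cur} {s = s} {w = x ∷ w} (stay ¬any ¬el ne _ _ lx sc) L c h
      rewrite T-¬⇒≡false ¬any | countᵇ-reject {p = isLead} w (λ l → ne (trans (sym (T-==⁻ l)) lx)) =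
        Scan-count sc (LinearAfter-same L) c step
      where
      step : ∀ u → lrCount (filterᵇ e ((cur ++ [ x ]) ++ u)) ≡ c + lrCountGo (suc (toℕ s)) (filterᵇ e u)
      step u rewrite ++-assoc cur [ x ] u | h (x ∷ u) with e x
      ... | false = refl
      ... | true rewrite T-¬⇒≡false {suc (toℕ s) ≤ᵇ toℕ x} (λ l → ¬el (tt , ≤ᵇ⇒≤ _ _ l)) = refl

  module _ {τ : Vec (Fin n) n} {lev : Fin n → ℕ} {lead : Fin n → Fin n} where

    Scan-reach : ∀ {e cur k s p w} → Scan lev lead (lookup τ) e cur k s p w → (∃ λ k → iter τ k s ≡ p) →
      All (λ x → ∃ λ k → iter τ k (lead x) ≡ x) w
    Scan-reach (done _) r = []
    Scan-reach (new _ _ _ lx sc) r = (0 , lx) ∷ Scan-reach sc (0 , refl)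
    Scan-reach (cut _ _ _ _ _ lx sc) r = (0 , lx) ∷ Scan-reach sc (0 , refl)
    Scan-reach {s = s} (stay _ _ _ refl _ lx sc) (j , r) =
      (suc j , trans (cong (λ l → iter τ (suc j) l) lx) r′) ∷ Scan-reach sc (suc j , r′)
      where r′ = cong (lookup τ) r

-- Extremal elements and sorted lists

Fin-min : {Q : Fin n → Set} → (∀ i → Dec (Q i)) → ∃ Q → ∃ λ i → Q i × (∀ j → Q j → toℕ i ≤ toℕ j)
Fin-min Q? (i , q) with least (λ k → anyᶠ? (λ j → Q? j ×-dec (toℕ j ≟ k))) (toℕ i) (i , q , refl)
... | _ , _ , (j , qj , refl) , min = j , qj , λ l ql → ≮⇒≥ (λ lt → min _ lt (l , ql , refl))

Fin-max : {Q : Fin n → Set} → (∀ i → Dec (Q i)) → ∃ Q → ∃ λ i → Q i × (∀ j → Q j → toℕ j ≤ toℕ i)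
Fin-max {n} Q? (i , q)
  with last-before (λ k → anyᶠ? (λ j → Q? j ×-dec (k ≤? toℕ j))) (i , q , z≤n) n (λ (j , _ , n≤j) → <⇒≱ (toℕ<n j) n≤j)
... | k , (j , qj , k≤j) , none = j , qj , λ l ql → ≤-trans (≮⇒≥ (λ lt → none (l , ql , lt))) k≤j

lookup-injective : (u v : Vec A n) → (∀ i → lookup u i ≡ lookup v i) → u ≡ v
lookup-injective u v eq = trans (sym (tabulate∘lookup u)) (trans (tabulate-cong eq) (tabulate∘lookup v))

sorted-unique : (f : A → ℕ) {xs ys : List A} →
  AllPairs (λ x y → f x < f y) xs → AllPairs (λ x y → f x < f y) ys →
  (∀ {z} → z ∈ xs → z ∈ ys) → (∀ {z} → z ∈ ys → z ∈ xs) → xs ≡ ys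
sorted-unique f {[]}     {[]}     _ _ _ _ = refl
sorted-unique f {[]}     {y ∷ ys} _ _ _ ⊇ with () ← ⊇ (here refl)
sorted-unique f {x ∷ xs} {[]}     _ _ ⊆ _ with () ← ⊆ (here refl)
sorted-unique f {x ∷ xs} {y ∷ ys} (x< ∷ sx) (y< ∷ sy) ⊆ ⊇ = cong₂ _∷_ x≡y (sorted-unique f sx sy ⊆′ ⊇′)
  where
  x≡y : x ≡ y
  x≡y with ⊆ (here refl) | ⊇ (here refl)
  ... | here eq  | _        = eq
  ... | there _  | here eq  = sym eq
  ... | there x∈ | there y∈ = contradiction (All.lookup y< x∈) (<-asym (All.lookup x< y∈))
  ⊆′ : ∀ {z} → z ∈ xs → z ∈ ys
  ⊆′ z∈ with ⊆ (there z∈)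
  ... | there z∈′ = z∈′
  ... | here refl = contradiction (cong f x≡y) (<⇒≢ (All.lookup x< z∈))
  ⊇′ : ∀ {z} → z ∈ ys → z ∈ xs
  ⊇′ z∈ with ⊇ (there z∈)
  ... | there z∈′ = z∈′
  ... | here refl = contradiction (cong f (sym x≡y)) (<⇒≢ (All.lookup y< z∈))

module _ {n : ℕ} {τ : Vec (Fin n) n} (inj : Injectiveᵛ τ) where
  open Perm τ inj

  abstract
    cycleMin : ∀ i → ∃ λ j → Reach i j × (∀ k → Reach i k → toℕ j ≤ toℕ k)
    cycleMin i = Fin-min (Reach? i) (i , Reach-refl)

-- Transversality and heights in `P/π`

module Transversality {n : ℕ} (P : Poset n) {τ : Vec (Fin n) n} (inj : Injectiveᵛ τ) where
  open Perm τ inj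
  open Foata P

  -- Along the closure of `QuotLe` one remains in a cycle or strictly gains potential, so two
  -- mutually related elements share a cycle. The order `_⊏_` is left open because heights in ℕ and
  -- coordinates in ℚ both serve as potentials.
  potential⇒transverse : {A : Set} (_⊏_ : A → A → Set) (f : Fin n → A) →
    (∀ {a} → ¬ (a ⊏ a)) → (∀ {a b c} → a ⊏ b → b ⊏ c → a ⊏ c) →
    (∀ {i j} → Reach i j → f i ≡ f j) → (∀ {i j} → i ≺ j → f i ⊏ f j) → IsPTransverseCycles P τ
  potential⇒transverse _⊏_ f ⊏-irrefl ⊏-trans f-cycle f-≺ = antichain , antisym
    where
    antichain : ∀ i j → SameCycle τ i j → ¬ (i ≺ j)
    antichain i j same i≺j = ⊏-irrefl (subst (f i ⊏_) (sym (f-cycle (SameCycle⇒Reach same))) (f-≺ i≺j))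
    step : ∀ {i j} → QuotLe P τ i j → Reach i j ⊎ f i ⊏ f j
    step (p , q , ip , jq , inj₁ refl) = inj₁ (Reach-trans (SameCycle⇒Reach ip) (Reach-sym (SameCycle⇒Reach jq)))
    step (p , q , ip , jq , inj₂ p≺q)  = inj₂ (subst₂ _⊏_ (sym (f-cycle (SameCycle⇒Reach ip)))
      (sym (f-cycle (SameCycle⇒Reach jq))) (f-≺ p≺q))
    combine : ∀ {i j k} → Reach i j ⊎ f i ⊏ f j → Reach j k ⊎ f j ⊏ f k → Reach i k ⊎ f i ⊏ f k
    combine (inj₁ r) (inj₁ r′) = inj₁ (Reach-trans r r′)
    combine {k = k} (inj₁ r) (inj₂ l) = inj₂ (subst (_⊏ f k) (sym (f-cycle r)) l)
    combine {i} (inj₂ l) (inj₁ r)     = inj₂ (subst (f i ⊏_) (f-cycle r) l)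
    combine (inj₂ l) (inj₂ l′)        = inj₂ (⊏-trans l l′)
    closure : ∀ {i j} → TransClosure (QuotLe P τ) i j → Reach i j ⊎ f i ⊏ f j
    closure [ q ]⁺    = step q
    closure (q ∷⁺ qs) = combine (step q) (closure qs)
    antisym : ∀ i j → TransClosure (QuotLe P τ) i j → TransClosure (QuotLe P τ) j i → SameCycle τ i j
    antisym i j i≤j j≤i with closure i≤j | closure j≤i
    ... | inj₁ r | _       = Reach⇒SameCycle r
    ... | inj₂ l | inj₁ r  = Reach⇒SameCycle (Reach-sym r)
    ... | inj₂ l | inj₂ l′ = contradiction (⊏-trans l l′) ⊏-irrefl

  Layout⇒transverse : Layout τ → IsPTransverseCycles P τ
  Layout⇒transverse D = potential⇒transverse _<_ lev (n≮n _) <-trans (Reach-invariant lev-τ) lev-≺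
    where open Layout D

  module _ (transverse : IsPTransverseCycles P τ) where

    private
      infix 4 _◁_
      _◁_ : Fin n → Fin n → Set
      i ◁ j = TransClosure (QuotLe P τ) i j × ¬ Reach i j

      Reach⇒QuotLe : ∀ {i j} → Reach i j → QuotLe P τ i j
      Reach⇒QuotLe {i} {j} r = j , j , Reach⇒SameCycle r , Reach⇒SameCycle Reach-refl , inj₁ refl

      ◁-trans : ∀ {i j k} → i ◁ j → j ◁ k → i ◁ k
      ◁-trans {i} {j} {k} (ij , ¬r) (jk , _) = ij ++⁺ jk , λ r →
        ¬r (SameCycle⇒Reach (proj₂ transverse i j ij (jk ++⁺ [ Reach⇒QuotLe (Reach-sym r) ]⁺)))

      ≺⇒◁ : ∀ {i j p} → Reach i j → p ≺ j → p ◁ i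
      ≺⇒◁ {i} {j} {p} r p≺j = [ p , j , Reach⇒SameCycle Reach-refl , Reach⇒SameCycle r , inj₂ p≺j ]⁺ ,
        λ r′ → proj₁ transverse p j (Reach⇒SameCycle (Reach-trans r′ r)) p≺j

      -- A descent of `k` steps in `P/π` from the cycle of `i`, each a move inside a cycle followed
      -- by a relation of `P`. In this form it is decidable by finite search, and the height is the
      -- largest such `k`.
      Chain : ℕ → Fin n → Set
      Chain zero    i = ⊤
      Chain (suc k) i = ∃ λ j → Reach i j × ∃ λ p → p ≺ j × Chain k p

      Chain? : ∀ k i → Dec (Chain k i)
      Chain? zero    i = yes tt
      Chain? (suc k) i = anyᶠ? λ j → Reach? i j ×-dec anyᶠ? λ p → T? (lt P p j) ×-dec Chain? k p

      Chain-pred : ∀ k {i} → Chain (suc k) i → Chain k i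
      Chain-pred zero    c                     = tt
      Chain-pred (suc k) (j , r , p , p≺j , c) = j , r , p , p≺j , Chain-pred k c

      Chain-≤ : ∀ {k l i} → k ≤ l → Chain l i → Chain k i
      Chain-≤ {k} {l} k≤l c with m≤n⇒m<n∨m≡n k≤l
      ... | inj₂ refl = c
      Chain-≤ {k} {suc l} k≤l c | inj₁ k<l = Chain-≤ (≤-pred k<l) (Chain-pred l c)

      Chain-cycle : ∀ k {i j} → Reach i j → Chain k i → Chain k j
      Chain-cycle zero    r c            = tt
      Chain-cycle (suc k) r (l , r′ , c) = l , Reach-trans (Reach-sym r) r′ , c

      Chain⇒list : ∀ k {i} → Chain k i → ∃ λ l → length l ≡ k × AllPairs (λ a b → b ◁ a) l × All (_◁ i) l
      Chain⇒list zero    c = [] , refl , [] , []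
      Chain⇒list (suc k) (j , r , p , p≺j , c) with Chain⇒list k c
      ... | l , len , pairs , below = p ∷ l , cong suc len , below ∷ pairs ,
        ≺⇒◁ r p≺j ∷ All.map (λ b◁p → ◁-trans b◁p (≺⇒◁ r p≺j)) below

      -- Together with `i`, the elements of such a chain would be `n + 1` distinct elements, since
      -- transversality makes `◁` transitive and irreflexive.
      Chain-bound : ∀ i → ¬ Chain n i
      Chain-bound i c with Chain⇒list n c
      ... | l , len , pairs , below = contradiction (unique⇒length≤ {xs = i ∷ l} (AllPairs.map distinct (below ∷ pairs)))
        (<⇒≱ (s≤s (≤-reflexive (sym len))))
        where
        distinct : ∀ {a b} → b ◁ a → a ≢ b
        distinct (_ , ¬r) refl = ¬r Reach-refl

      abstract
        height : ∀ i → ∃ λ k → Chain k i × ¬ Chain (suc k) i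
        height i = last-before (λ k → Chain? k i) tt n (Chain-bound i)

      lev : Fin n → ℕ
      lev i = proj₁ (height i)

      Chain⇒≤lev : ∀ k {i} → Chain k i → k ≤ lev i
      Chain⇒≤lev k {i} c = ≮⇒≥ λ lt → proj₂ (proj₂ (height i)) (Chain-≤ lt c)

      lev-cycle : ∀ {i j} → Reach i j → lev i ≡ lev j
      lev-cycle {i} {j} r = ≤-antisym (Chain⇒≤lev _ (Chain-cycle _ r (proj₁ (proj₂ (height i)))))
        (Chain⇒≤lev _ (Chain-cycle _ (Reach-sym r) (proj₁ (proj₂ (height j)))))

      lev-≺ : ∀ {x y} → x ≺ y → lev x < lev y
      lev-≺ {x} {y} x≺y = Chain⇒≤lev (suc (lev x)) (y , Reach-refl , x , x≺y , proj₁ (proj₂ (height x)))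

      Candidate : Fin n → Fin n → Set
      Candidate i z = Reach i z × Essential lev z

      Candidate? : ∀ i z → Dec (Candidate i z)
      Candidate? i z = Reach? i z ×-dec ((lev z ≟ 0) ⊎-dec anyᶠ? λ p → T? (lt P p z) ×-dec (lev z ≟ suc (lev p)))

      -- In a longest chain below the cycle of `i`, the first relation `p ≺ j` ends at an essential
      -- `j`. The number `k` is kept apart from `lev i` so that the chain can be matched on.
      candidate : ∀ i k → Chain k i → k ≡ lev i → ∃ (Candidate i)
      candidate i zero    c eq = i , Reach-refl , inj₁ (sym eq)
      candidate i (suc k) (j , r , p , p≺j , c) eq = j , r , inj₂ (p , p≺j , lev-j)
        where
        k≡ : suc k ≡ lev j
        k≡ = trans eq (lev-cycle r)
        -- The remaining `k` steps start at `p`, so `lev p` is at least `k`; it is at most `k`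
        -- because `p ≺ j`.
        lev-j : lev j ≡ suc (lev p)
        lev-j = ≤-antisym (subst (_≤ suc (lev p)) k≡ (s≤s (Chain⇒≤lev k c))) (lev-≺ p≺j)

      abstract
        largest : ∀ i → ∃ λ m → Candidate i m × (∀ z → Candidate i z → toℕ z ≤ toℕ m)
        largest i = Fin-max (Candidate? i) (candidate i _ (proj₁ (proj₂ (height i))) refl)

    transverse⇒Layout : Layout τ
    transverse⇒Layout = record
      { lev            = lev
      ; lead           = λ i → proj₁ (largest i)
      ; lev-τ          = λ i → sym (lev-cycle Reach-step)
      ; lev-≺          = lev-≺
      ; lead-τ         = λ i → toℕ-injective (≤-antisym (larger (Reach-step {i})) (larger (Reach-sym (Reach-step {i}))))
      ; lead-reach     = λ i → Reach-sym (proj₁ (proj₁ (proj₂ (largest i))))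
      ; lead-essential = λ i → proj₂ (proj₁ (proj₂ (largest i)))
      ; lead-max       = λ i ess → proj₂ (proj₂ (largest i)) i (Reach-refl , ess)
      }
      where
      larger : ∀ {i j} → Reach i j → toℕ (proj₁ (largest j)) ≤ toℕ (proj₁ (largest i))
      larger {i} {j} r with largest j
      ... | m , (r′ , ess) , _ = proj₂ (proj₂ (largest i)) m (Reach-trans r r′ , ess)

-- The correspondence between permutations and linear extensions

module Correspondence {n : ℕ} (P : Poset n) where
  open Foata P
  open FoataScan P
  open Transversality P

  ScanWord : (lev : Fin n → ℕ) (lead t : Fin n → Fin n) → List (Fin n) → Set
  ScanWord lev lead t []      = ⊤
  ScanWord lev lead t (x ∷ w) = lev x ≡ 0 × lead x ≡ x × Scan lev lead t (λ _ → true) [ x ] 0 x x w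

  ScanWord-functional : ∀ {lev lev′ lead lead′ t t′} w → ScanWord lev lead t w → ScanWord lev′ lead′ t′ w →
    ∀ {y} → y ∈ w → t y ≡ t′ y
  ScanWord-functional (x ∷ w) (_ , _ , sc) (_ , _ , sc′) = Scan-functional sc sc′

  Linear : List (Fin n) → Set
  Linear = AllPairs (λ x y → ¬ (y ≺ x))

  Linear⇒LinearAfter : ∀ {x w} → Linear (x ∷ w) → LinearAfter [ x ] w
  Linear⇒LinearAfter (x< ∷ lin) = linearAfter (λ { (here refl) → All.lookup x< }) lin

  ScanWord-LRmax : ∀ {lev lead t} w → ScanWord lev lead t w → Linear w →
    LRmaxFromLevels P (levels P w) ≡ countᵇ (λ x → lead x == x) w
  ScanWord-LRmax []      _ _ = refl
  ScanWord-LRmax {lev} {lead} {t} (x ∷ w) (_ , lx , sc) lin =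
    trans (LRmax-total (levelsGo P [ x ] w))
      (trans (Scan-count sc (Linear⇒LinearAfter lin) 1 (λ _ → refl))
        (sym (countᵇ-accept w (T-==⁺ lx))))

  module _ {τ : Vec (Fin n) n} (inj : Injectiveᵛ τ) (D : Layout τ) where
    open Perm τ inj
    open Key inj D

    Sorted : List (Fin n) → Set
    Sorted = AllPairs (λ x y → key x < key y)

    Sorted⇒ScanWord : ∀ w → Sorted w → (∀ z → z ∈ w) → ScanWord lev lead (lookup τ) w
    Sorted⇒ScanWord []      _ _ = tt
    Sorted⇒ScanWord (x ∷ w) srt@(x< ∷ _) all = lev-x , lead-x ,
      sorted⇒Scan inj D w (Inv-start all lev-x) srt seen lead-x lev-x
      where
      first : ∀ z → key x ≤ key z
      first z with all z
      ... | here refl = ≤-refl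
      ... | there z∈  = <⇒≤ (All.lookup x< z∈)
      seen : ∀ z → z ∈ w ⊎ key z ≤ key x
      seen z with all z
      ... | here refl = inj₂ ≤-refl
      ... | there z∈  = inj₁ z∈
      lead-x : lead x ≡ x
      lead-x = key-injective (≤-antisym (key-leader (lead-idem x) refl) (first (lead x)))
      lev-x : lev x ≡ 0
      lev-x with lead-essential x
      ... | inj₁ z             = trans (sym (lev-lead x)) z
      ... | inj₂ (q , q≺l , _) =
        contradiction (key⇒lev≤ (first q)) (<⇒≱ (subst (lev q <_) (lev-lead x) (lev-≺ q≺l)))

    Sorted⇒Linear : ∀ {w} → Sorted w → Linear w
    Sorted⇒Linear = AllPairs.map λ l y≺x → <-asym l (key-lev (lev-≺ y≺x))

    -- Cycle minima and leaders are two systems of representatives of the cycles, matched in both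
    -- directions by `Reach`.
    cyc≡leads : ∀ {w} → Unique w → (∀ z → z ∈ w) → cyc τ ≡ countᵇ (λ x → lead x == x) w
    cyc≡leads {w} u all = ≤-antisym
      (countᵇ-≤ (λ x y → Reach x y × T (isCycleMin x))
        (λ (r , mx) (r′ , mx′) → toℕ-injective (≤-antisym
          (isCycleMin⁻ mx (Reach-trans r (Reach-sym r′))) (isCycleMin⁻ mx′ (Reach-trans r′ (Reach-sym r)))))
        (allFin⁺ n)
        (λ {x} _ mx → lead x , all _ , T-==⁺ (lead-idem x) , Reach-sym (lead-reach x) , mx))
      (countᵇ-≤ (λ x y → Reach x y × lead x ≡ x)
        (λ (r , lx) (r′ , lx′) → trans (sym lx) (trans (Reach-invariant lead-τ (Reach-trans r (Reach-sym r′))) lx′))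
        u
        (λ {x} _ lx → let j , r , min = cycleMin inj x in
          j , ∈-allFin j , isCycleMin⁺ (λ r′ → min _ (Reach-trans r r′)) , r , T-==⁻ lx))

    sortedList : ∃ λ w → Sorted w × Unique w × length w ≡ n
    sortedList = w , AllPairs.zipWith (λ (le , ne) → ≤∧≢⇒< le (ne ∘ key-injective))
        (Linked⇒AllPairs ≤-trans (S.sort-↗ (allFin n)) , u) , u , trans (↭-length w↭) (length-allFin n)
      where
      module S = Sort (On.decTotalOrder ≤-decTotalOrder key)
      w = S.sort (allFin n)
      w↭ : w ↭ allFin n
      w↭ = S.sort-↭ (allFin n)
      u : Unique w
      u = Unique-resp-↭ (setoid (Fin n)) (↭⇒↭ₛ (↭-sym w↭)) (allFin⁺ n)

  -- A scan of the word supplies the permutation together with its levels and leaders; the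
  -- conditions of a layout are then read off from the scan.
  unscan : ∀ w → Unique w → (∀ z → z ∈ w) → Linear w →
    ∃ λ τ → Σ (Injectiveᵛ τ) λ inj → Σ (Layout τ) λ D → Sorted inj D w
  -- An empty word that contains every letter forces `n` to be 0.
  unscan [] u all lin = tabulate id , (λ {p} → case all p of λ ()) , record
    { lev = λ _ → 0 ; lead = id ; lev-τ = λ _ → refl ; lev-≺ = λ {x} → case all x of λ () ; lead-τ = λ x → case all x of λ ()
    ; lead-reach = λ _ → 0 , refl ; lead-essential = λ _ → inj₁ refl ; lead-max = λ _ _ → ≤-refl } , []
  unscan (x ∷ w) u@(x∉ ∷ _) all lin with Scan-exists {λ _ → true} {[ x ]} {0} {x} w u (λ x∈ → All.lookup x∉ x∈ refl)
  ... | lev₀ , lead₀ , t , sc₀ = τ , inj , D , Linked⇒AllPairs <-trans (Linked.map next⇒< (Scan-linked sc lead-x lev-x))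
    where
    τ : Vec (Fin n) n
    τ = tabulate t
    -- The scan prescribes levels and leaders only after the first letter, so the values at `x` are
    -- set here.
    lev : Fin n → ℕ
    lev = updateAt lev₀ x (const 0)
    lead : Fin n → Fin n
    lead = updateAt lead₀ x (const x)
    lev-x : lev x ≡ 0
    lev-x = updateAt-updates x lev₀
    lead-x : lead x ≡ x
    lead-x = updateAt-updates x lead₀
    sc : Scan lev lead (lookup τ) (λ _ → true) [ x ] 0 x x w
    sc = Scan-cong (λ y∈ → let y≢x = λ y≡x → All.lookup x∉ y∈ (sym y≡x) in
        sym (updateAt-minimal _ x lev₀ y≢x) , sym (updateAt-minimal _ x lead₀ y≢x))
      (λ {y} _ → sym (lookup∘tabulate t y)) sc₀
    -- The images of the letters rearrange the word, which has no repetitions.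
    images : AllPairs (λ y z → lookup τ y ≢ lookup τ z) (x ∷ w)
    images = AllPairs-map⁻ (Unique-resp-↭ (setoid (Fin n)) (↭⇒↭ₛ (↭-sym (Scan-permutes sc))) u)
    inj : Injectiveᵛ τ
    inj {p} {q} eq with ∈-AllPairs₂ images (all p) (all q)
    ... | inj₁ p≡q       = p≡q
    ... | inj₂ (inj₁ ne) = contradiction eq ne
    ... | inj₂ (inj₂ ne) = contradiction (sym eq) ne
    invariant : ∀ i → lead (lookup τ i) ≡ lead i × lev (lookup τ i) ≡ lev i
    invariant i = All.lookup (Scan-invariant sc lead-x lead-x lev-x lev-x) (all i)
    good : ∀ i → Essential lev (lead i) × (Essential lev i → toℕ i ≤ toℕ (lead i))
    good i with all i
    ... | there i∈ = All.lookup (Scan-lead sc (Inv-start all lev-x) (Linear⇒LinearAfter lin) (inj₁ lev-x)) i∈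
    ... | here refl = subst (Essential lev) (sym lead-x) (inj₁ lev-x) , λ _ → ≤-reflexive (cong toℕ (sym lead-x))
    reach : ∀ i → ∃ λ k → iter τ k (lead i) ≡ i
    reach i with all i
    ... | there i∈ = All.lookup (Scan-reach sc (0 , refl)) i∈
    ... | here refl = 0 , lead-x
    D : Layout τ
    D = record
      { lev = lev ; lead = lead ; lev-τ = proj₂ ∘ invariant ; lev-≺ = Scan-lev-≺ sc lev-x lin (all _) (all _)
      ; lead-τ = proj₁ ∘ invariant ; lead-reach = reach ; lead-essential = proj₁ ∘ good ; lead-max = proj₂ ∘ good }
    open Key inj D using (key; key-lev; key-lead; key-τ)
    next⇒< : ∀ {y z} → Next {lev} {lead} {lookup τ} y z → key y < key z
    next⇒< (inj₁ l)                                  = key-lev l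
    next⇒< (inj₂ (eq , inj₁ l))                      = key-lead eq l
    next⇒< {y} (inj₂ (_ , inj₂ (_ , refl , ne))) = ≤-reflexive (sym (key-τ y ne))

  -- The graph of the correspondence. The layout is packed inside, so it need not be the one
  -- computed from a proof of transversality.
  SortedBy : Vec (Fin n) n → Vec (Fin n) n → Set
  SortedBy τ σ = Σ (Injectiveᵛ τ) λ inj → Σ (Layout τ) λ D → Sorted inj D (toList σ)

  -- Both permutations are read off from scans of the same word.
  SortedBy-injective : ∀ {τ τ′ σ} → Injectiveᵛ σ → SortedBy τ σ → SortedBy τ′ σ → τ ≡ τ′
  SortedBy-injective {τ} {τ′} {σ} σ-inj (inj , D , srt) (inj′ , D′ , srt′) = lookup-injective τ τ′ λ i →
    ScanWord-functional (toList σ) (Sorted⇒ScanWord inj D _ srt complete) (Sorted⇒ScanWord inj′ D′ _ srt′ complete) (complete i)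
    where complete = ∈-toList-perm σ σ-inj

  SortedBy-functional : ∀ {τ σ σ′} → Injectiveᵛ σ → Injectiveᵛ σ′ → SortedBy τ σ → SortedBy τ σ′ → σ ≡ σ′
  SortedBy-functional {τ} {σ} {σ′} σ-inj σ′-inj (inj , D , srt) (inj′ , D′ , srt′) = toList-injective σ σ′
    (sorted-unique (Key.key inj D) srt
      (AllPairs.map (λ {x} {y} → subst₂ _<_ (same x) (same y)) srt′)
      (λ _ → ∈-toList-perm σ′ σ′-inj _) (λ _ → ∈-toList-perm σ σ-inj _))
    where
    same : ∀ i → Key.key inj′ D′ i ≡ Key.key inj D i
    same i = sym (key-unique inj inj′ D D′ i)

  SortedBy-cyc : ∀ {τ σ} → Injectiveᵛ σ → SortedBy τ σ → cyc τ ≡ LRmax P σ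
  SortedBy-cyc {τ} {σ} σ-inj (inj , D , srt) = trans (cyc≡leads inj D (Injectiveᵛ⇒Unique σ σ-inj) complete)
    (sym (ScanWord-LRmax (toList σ) (Sorted⇒ScanWord inj D _ srt complete) (Sorted⇒Linear inj D srt)))
    where complete = ∈-toList-perm σ σ-inj

  abstract
    linearise : (τ : STransverse P) → ∃ λ (σ : LinExt P) → SortedBy (proj₁ τ) (proj₁ σ)
    linearise (τ , perm , transverse) with transverse⇒Layout (isPerm⁻ τ perm) transverse
    ... | D with sortedList (isPerm⁻ τ perm) D
    ... | w , srt , u , len with fromList w len | toList-fromList w len
    ... | σ | refl = (σ , isPerm⁺ σ (Unique⇒Injectiveᵛ σ u) , isLinExt⁺ P σ (Sorted⇒Linear (isPerm⁻ τ perm) D srt)) ,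
      isPerm⁻ τ perm , D , srt

    delinearise : (σ : LinExt P) → ∃ λ (τ : STransverse P) → SortedBy (proj₁ τ) (proj₁ σ)
    delinearise (σ , perm , lin)
      with unscan (toList σ) (Injectiveᵛ⇒Unique σ (isPerm⁻ σ perm)) (∈-toList-perm σ (isPerm⁻ σ perm)) (isLinExt⁻ P σ lin)
    ... | τ , inj , D , srt = (τ , isPerm⁺ τ inj , Layout⇒transverse inj D) , inj , D , srt

-- Enumeration of vectors

∈-allVecs : (v : Vec (Fin n) m) → v ∈ allVecs n m
∈-allVecs []ᵥ      = here refl
∈-allVecs (x ∷ᵥ v) = ∈-concatMap⁺ _ (lose (∈-allFin x) (∈-map⁺ (x ∷ᵥ_) (∈-allVecs v)))

allVecs-unique : ∀ n m → Unique (allVecs n m)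
allVecs-unique n zero    = [] ∷ []
allVecs-unique n (suc m) = Unique-concat⁺
  (All-map⁺ (All.universal (λ x → Unique-map⁺ (λ { refl → refl }) (allVecs-unique n m)) (allFin n)))
  (AllPairs-map⁺ (AllPairs.map disjoint (allFin⁺ n)))
  where
  disjoint : ∀ {x y} → x ≢ y → ∀ {v} → ¬ (v ∈ map (x ∷ᵥ_) (allVecs n m) × v ∈ map (y ∷ᵥ_) (allVecs n m))
  disjoint x≢y (v∈ , v∈′) with ∈-map⁻ _ v∈ | ∈-map⁻ _ v∈′
  ... | _ , _ , refl | _ , _ , refl = x≢y refl

T-eqFlat⁻ : (X Y : Vec (Fin n) n) → T (eqFlat X Y) → X ≡ Y
T-eqFlat⁻ X Y t = lookup-injective X Y λ i → T-==⁻ (T-allP⁻ {p = λ i → lookup X i == lookup Y i} t i)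

T-eqFlat⁺ : (X Y : Vec (Fin n) n) → X ≡ Y → T (eqFlat X Y)
T-eqFlat⁺ X _ refl = T-allP⁺ {p = λ i → lookup X i == lookup X i} λ i → T-==⁺ refl

-- Sums over lists

module ListSum {M : Set} {_∙_ : M → M → M} {ε : M} (isCM : IsCommutativeMonoid _≡_ _∙_ ε) where
  open IsCommutativeMonoid isCM using (assoc; comm; identityˡ; identityʳ)

  ∑ : List A → (A → M) → M
  ∑ []       f = ε
  ∑ (x ∷ xs) f = f x ∙ ∑ xs f

  when : Bool → M → M
  when b z = if b then z else ε

  when-∙ : ∀ b y z → when b (y ∙ z) ≡ when b y ∙ when b z
  when-∙ true  y z = refl
  when-∙ false y z = sym (identityˡ ε)

  when-ε : ∀ b → when b ε ≡ ε
  when-ε true  = refl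
  when-ε false = refl

  ∑-cong : {f g : A → M} (xs : List A) → (∀ {x} → x ∈ xs → f x ≡ g x) → ∑ xs f ≡ ∑ xs g
  ∑-cong []       eq = refl
  ∑-cong (x ∷ xs) eq = cong₂ _∙_ (eq (here refl)) (∑-cong xs (eq ∘ there))

  ∑-ε : (xs : List A) → ∑ xs (λ _ → ε) ≡ ε
  ∑-ε []       = refl
  ∑-ε (x ∷ xs) = trans (identityˡ _) (∑-ε xs)

  ∑-∙ : (xs : List A) (f g : A → M) → ∑ xs (λ x → f x ∙ g x) ≡ ∑ xs f ∙ ∑ xs g
  ∑-∙ []       f g = sym (identityˡ ε)
  ∑-∙ (x ∷ xs) f g = begin
    (f x ∙ g x) ∙ ∑ xs (λ x → f x ∙ g x) ≡⟨ cong ((f x ∙ g x) ∙_) (∑-∙ xs f g) ⟩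
    (f x ∙ g x) ∙ (∑ xs f ∙ ∑ xs g)      ≡⟨ assoc (f x) (g x) _ ⟩
    f x ∙ (g x ∙ (∑ xs f ∙ ∑ xs g))      ≡⟨ cong (f x ∙_) (sym (assoc (g x) (∑ xs f) (∑ xs g))) ⟩
    f x ∙ ((g x ∙ ∑ xs f) ∙ ∑ xs g)      ≡⟨ cong (λ z → f x ∙ (z ∙ ∑ xs g)) (comm (g x) (∑ xs f)) ⟩
    f x ∙ ((∑ xs f ∙ g x) ∙ ∑ xs g)      ≡⟨ cong (f x ∙_) (assoc (∑ xs f) (g x) (∑ xs g)) ⟩
    f x ∙ (∑ xs f ∙ (g x ∙ ∑ xs g))      ≡⟨ sym (assoc (f x) _ _) ⟩
    (f x ∙ ∑ xs f) ∙ (g x ∙ ∑ xs g)      ∎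
    where open ≡-Reasoning

  ∑-filterᵇ : (p : A → Bool) (xs : List A) (f : A → M) → ∑ (filterᵇ p xs) f ≡ ∑ xs (λ x → when (p x) (f x))
  ∑-filterᵇ p []       f = refl
  ∑-filterᵇ p (x ∷ xs) f with p x
  ... | true  = cong (f x ∙_) (∑-filterᵇ p xs f)
  ... | false = trans (∑-filterᵇ p xs f) (sym (identityˡ _))

  ∑-delta : {xs : List A} (δ : A → Bool) (f : A → M) {y : A} → Unique xs → y ∈ xs →
    T (δ y) → (∀ {x} → x ∈ xs → T (δ x) → x ≡ y) → ∑ xs (λ x → when (δ x) (f x)) ≡ f y
  ∑-delta {xs = x ∷ xs} δ f (x∉ ∷ u) (here refl) δy only rewrite to T-≡ δy =
    trans (cong (f x ∙_) (trans (∑-cong xs vanish) (∑-ε xs))) (identityʳ (f x))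
    where
    vanish : ∀ {z} → z ∈ xs → when (δ z) (f z) ≡ ε
    vanish {z} z∈ rewrite T-¬⇒≡false {δ z} (λ δz → All.lookup x∉ z∈ (sym (only (there z∈) δz))) = refl
  ∑-delta {xs = x ∷ xs} δ f (x∉ ∷ u) (there y∈) δy only
    rewrite T-¬⇒≡false {δ x} (λ δx → All.lookup x∉ y∈ (only (here refl) δx)) =
    trans (identityˡ _) (∑-delta δ f u y∈ δy (only ∘ there))

  -- Exchange of summations: each `t` contributes only at `x ≡ π t`. The test `_≐_` stands for this
  -- equation.
  ∑-fibre : {xs : List A} (ts : List B) (c : A → Bool) (_≐_ : B → A → Bool) (π : B → A) (h : B → M) → Unique xs →
    (∀ {t} → t ∈ ts → π t ∈ xs × T (t ≐ π t) × (∀ {x} → T (t ≐ x) → x ≡ π t)) →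
    ∑ xs (λ x → when (c x) (∑ ts λ t → when (t ≐ x) (h t))) ≡ ∑ ts (λ t → when (c (π t)) (h t))
  ∑-fibre {xs = xs} [] c _≐_ π h u on = trans (∑-cong xs (λ {x} _ → when-ε (c x))) (∑-ε xs)
  ∑-fibre {xs = xs} (t ∷ ts) c _≐_ π h u on = begin
    ∑ xs (λ x → when (c x) (when (t ≐ x) (h t) ∙ ∑ ts (λ t → when (t ≐ x) (h t))))
      ≡⟨ ∑-cong xs (λ {x} _ → trans (when-∙ (c x) _ _) (cong (_∙ _) (when-comm (c x) (t ≐ x) (h t)))) ⟩
    ∑ xs (λ x → when (t ≐ x) (when (c x) (h t)) ∙ when (c x) (∑ ts (λ t → when (t ≐ x) (h t))))
      ≡⟨ ∑-∙ xs _ _ ⟩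
    ∑ xs (λ x → when (t ≐ x) (when (c x) (h t))) ∙ ∑ xs (λ x → when (c x) (∑ ts (λ t → when (t ≐ x) (h t))))
      ≡⟨ cong₂ _∙_ (let πt∈ , ≐π , only = on (here refl) in ∑-delta (t ≐_) _ u πt∈ ≐π (λ _ → only))
           (∑-fibre ts c _≐_ π h u (on ∘ there)) ⟩
    when (c (π t)) (h t) ∙ ∑ ts (λ t → when (c (π t)) (h t)) ∎
    where
    open ≡-Reasoning
    when-comm : ∀ a b z → when a (when b z) ≡ when b (when a z)
    when-comm true  b z = refl
    when-comm false b z = sym (when-ε b)

  -- Both sides are the double sum over pairs `t`, `x` with `ι t ≐ x`, collapsed along one variable
  -- or the other.
  ∑-involution : {ts : List A} (_≐_ : A → A → Bool) → (∀ {s t} → T (s ≐ t) → s ≡ t) → (∀ {t} → T (t ≐ t)) →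
    (ι : A → A) → (∀ t → ι (ι t) ≡ t) → Unique ts → (∀ {t} → t ∈ ts → ι t ∈ ts) → (f : A → M) →
    ∑ ts (λ t → f (ι t)) ≡ ∑ ts f
  ∑-involution {ts = ts} _≐_ ≐⇒≡ ≐-refl ι invol u closed f = begin
    ∑ ts (λ t → f (ι t))
      ≡⟨ sym (∑-fibre ts (λ _ → true) (λ t x → ι t ≐ x) ι (f ∘ ι) u
           (λ t∈ → closed t∈ , ≐-refl , λ e → sym (≐⇒≡ e))) ⟩
    ∑ ts (λ x → ∑ ts (λ t → when (ι t ≐ x) (f (ι t))))
      ≡⟨ ∑-cong ts (λ {x} x∈ → trans
           (∑-delta (λ t → ι t ≐ x) (f ∘ ι) {ι x} u (closed x∈) (subst (λ z → T (z ≐ x)) (sym (invol x)) ≐-refl)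
             (λ {z} _ e → trans (sym (invol z)) (cong ι (≐⇒≡ e))))
           (cong f (invol x))) ⟩
    ∑ ts f ∎
    where open ≡-Reasoning

-- The cycle partition as a canonical label vector

canon : Vec (Fin n) n → Vec (Fin n) n
canon τ with T? (isPerm τ)
... | yes p = tabulate (λ i → proj₁ (cycleMin {τ = τ} (isPerm⁻ τ p) i))
-- A default that keeps `canon` total, so that sums can use it without carrying proofs of
-- injectivity.
... | no _  = τ

module Canon {n : ℕ} {τ : Vec (Fin n) n} (inj : Injectiveᵛ τ) where
  open Perm τ inj

  private
    canon-spec : ∀ i → Reach i (lookup (canon τ) i) × (∀ k → Reach i k → toℕ (lookup (canon τ) i) ≤ toℕ k)
    canon-spec i with T? (isPerm τ)
    ... | no ¬p = contradiction (isPerm⁺ τ inj) ¬p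
    ... | yes p = subst (λ m → Reach i m × (∀ k → Reach i k → toℕ m ≤ toℕ k))
      (sym (lookup∘tabulate (λ i → proj₁ (cycleMin {τ = τ} (isPerm⁻ τ p) i)) i)) (proj₂ (cycleMin (isPerm⁻ τ p) i))

  canon-reach : ∀ i → Reach i (lookup (canon τ) i)
  canon-reach i = proj₁ (canon-spec i)

  canon-min : ∀ {i j} → Reach i j → toℕ (lookup (canon τ) i) ≤ toℕ j
  canon-min {i} r = proj₂ (canon-spec i) _ r

  Reach⇒canon≡ : ∀ {i j} → Reach i j → lookup (canon τ) i ≡ lookup (canon τ) j
  Reach⇒canon≡ {i} {j} r = toℕ-injective (≤-antisym
    (canon-min (Reach-trans r (canon-reach j))) (canon-min (Reach-trans (Reach-sym r) (canon-reach i))))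

  canon≡⇒Reach : ∀ {i j} → lookup (canon τ) i ≡ lookup (canon τ) j → Reach i j
  canon≡⇒Reach {i} {j} eq = Reach-trans (canon-reach i) (subst (λ m → Reach m j) (sym eq) (Reach-sym (canon-reach j)))

  canon-canonical : T (isCanon (canon τ))
  canon-canonical = T-allP⁺ λ i → from T-∧ (T-==⁺ (sym (Reach⇒canon≡ (canon-reach i))) , ≤⇒≤ᵇ (canon-min Reach-refl))

  isCycleMin≡ : ∀ i → (lookup (canon τ) i == i) ≡ isCycleMin i
  isCycleMin≡ i = T-⇔⇒≡
    (λ t → isCycleMin⁺ (λ r → subst (λ m → toℕ m ≤ _) (T-==⁻ t) (canon-min r)))
    (λ t → T-==⁺ (toℕ-injective (≤-antisym (canon-min Reach-refl) (isCycleMin⁻ t (canon-reach i)))))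

  codim-canon : codim (canon τ) ≡ n ∸ cyc τ
  codim-canon = cong (n ∸_) (countᵇ-cong isCycleMin≡ (allFin n))

countᵇ-remove : {p q : A → Bool} {y : A} {xs : List A} → Unique xs → y ∈ xs → T (p y) → ¬ T (q y) →
  (∀ x → T (q x) → T (p x)) → (∀ x → T (p x) → x ≢ y → T (q x)) → (∀ x → Dec (x ≡ y)) →
  countᵇ p xs ≡ suc (countᵇ q xs)
countᵇ-remove {p = p} {q} {y} {xs} u y∈ py ¬qy q⇒p p⇒q _≟y = ≤-antisym
  (injection⇒length-≤ _≡_ (λ { refl refl → refl }) (filterᵇ-unique p u) forth)
  (injection⇒length-≤ _≡_ (λ { refl refl → refl })
    (All.tabulate (λ { {z} z∈ refl → ¬qy (proj₂ (∈-filterᵇ⁻ xs z∈)) }) ∷ filterᵇ-unique q u) back)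
  where
  forth : ∀ {x} → x ∈ filterᵇ p xs → ∃ λ z → z ∈ y ∷ filterᵇ q xs × x ≡ z
  forth {x} x∈ with ∈-filterᵇ⁻ xs x∈ | x ≟y
  ... | _       | yes eq = x , here eq , refl
  ... | x∈ , px | no ne  = x , there (∈-filterᵇ⁺ x∈ (p⇒q x px ne)) , refl
  back : ∀ {x} → x ∈ y ∷ filterᵇ q xs → ∃ λ z → z ∈ filterᵇ p xs × x ≡ z
  back (here refl) = y , ∈-filterᵇ⁺ y∈ py , refl
  back {x} (there x∈) with ∈-filterᵇ⁻ xs x∈
  ... | x∈′ , qx = x , ∈-filterᵇ⁺ x∈′ (q⇒p x qx) , refl

-- Composition with a transposition

record Swapped {n : ℕ} (a b : Fin n) (τ τ′ : Vec (Fin n) n) : Set where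
  field
    at-a  : lookup τ′ a ≡ lookup τ b
    at-b  : lookup τ′ b ≡ lookup τ a
    other : ∀ {i} → i ≢ a → i ≢ b → lookup τ′ i ≡ lookup τ i

module _ {n : ℕ} {a b : Fin n} {τ τ′ : Vec (Fin n) n} where

  Swapped-ends : Swapped a b τ τ′ → Swapped b a τ τ′
  Swapped-ends S = record { at-a = at-b ; at-b = at-a ; other = λ i≢b i≢a → other i≢a i≢b }
    where open Swapped S

  Swapped-sym : Swapped a b τ τ′ → Swapped a b τ′ τ
  Swapped-sym S = record { at-a = sym at-b ; at-b = sym at-a ; other = λ i≢a i≢b → sym (other i≢a i≢b) }
    where open Swapped S

module Merge {n : ℕ} {τ τ′ : Vec (Fin n) n} (inj : Injectiveᵛ τ) (inj′ : Injectiveᵛ τ′) where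
  open Perm τ inj
  module Pτ′ = Perm τ′ inj′

  private
    iter-shift : ∀ k i → iter τ k (lookup τ i) ≡ iter τ (suc k) i
    iter-shift k i = trans (sym (iter-+ k 1 i)) (cong (λ l → iter τ l i) (+-comm k 1))

    -- Until it first meets `a`, the walk under `τ` cannot meet `b`, which lies in another cycle; so
    -- `τ′` makes the same steps.
    reach-a : ∀ {a b} → Swapped a b τ τ′ → ¬ Reach a b → ∀ k {i} → iter τ k i ≡ a → Pτ′.Reach i a
    reach-a S a≁b zero refl = Pτ′.Reach-refl
    reach-a {a} {b} S a≁b (suc k) {i} eq with i ≟ᶠ a | i ≟ᶠ b
    ... | yes refl | _        = Pτ′.Reach-refl
    ... | no _     | yes refl = contradiction (Reach-sym (suc k , eq)) a≁b
    ... | no i≢a   | no i≢b   = Pτ′.Reach-trans (1 , Swapped.other S i≢a i≢b) (reach-a S a≁b k (trans (iter-shift k i) eq))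

  module _ {a b : Fin n} (S : Swapped a b τ τ′) (a≁b : ¬ Reach a b) where
    open Swapped S

    a∼′b : Pτ′.Reach a b
    a∼′b with Reach-sym (Reach-step {b})
    ... | k , eq = Pτ′.Reach-trans (1 , at-a) (reach-a (Swapped-ends S) (a≁b ∘ Reach-sym) k eq)

    Reach⊆Reach′ : ∀ {i j} → Reach i j → Pτ′.Reach i j
    Reach⊆Reach′ (zero  , refl) = Pτ′.Reach-refl
    Reach⊆Reach′ {i} (suc k , refl) = Pτ′.Reach-trans (Reach⊆Reach′ (k , refl)) (step (iter τ k i))
      where
      step : ∀ i → Pτ′.Reach i (lookup τ i)
      step i with i ≟ᶠ a | i ≟ᶠ b
      ... | yes refl | _        = Pτ′.Reach-trans a∼′b (1 , at-b)
      ... | no _     | yes refl = Pτ′.Reach-trans (Pτ′.Reach-sym a∼′b) (1 , at-a)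
      ... | no i≢a   | no i≢b   = 1 , other i≢a i≢b

    private
      -- Cycle labels of `τ` with the cycle of `b` relabelled as that of `a`. They are constant
      -- along `τ′`, so `τ′` joins nothing beyond these two cycles.
      class : Fin n → Fin n
      class i with Reach? i b
      ... | yes _ = lookup (canon τ) a
      ... | no _  = lookup (canon τ) i

      class-∼b : ∀ {i} → Reach i b → class i ≡ lookup (canon τ) a
      class-∼b {i} r with Reach? i b
      ... | yes _ = refl
      ... | no ¬r = contradiction r ¬r

      class-≁b : ∀ {i} → ¬ Reach i b → class i ≡ lookup (canon τ) i
      class-≁b {i} ¬r with Reach? i b
      ... | yes r = contradiction r ¬r
      ... | no _  = refl

      class-cycle : ∀ {i j} → Reach i j → class i ≡ class j
      class-cycle {i} {j} r with Reach? j b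
      ... | yes j∼b = class-∼b (Reach-trans r j∼b)
      ... | no j≁b  = trans (class-≁b (j≁b ∘ Reach-trans (Reach-sym r))) (Canon.Reach⇒canon≡ {τ = τ} inj r)

      class-τ′ : ∀ i → class (lookup τ′ i) ≡ class i
      class-τ′ i with i ≟ᶠ a | i ≟ᶠ b
      ... | yes refl | _        = trans (cong class at-a)
              (trans (class-∼b (Reach-sym Reach-step)) (sym (class-≁b a≁b)))
      ... | no _     | yes refl = trans (cong class at-b)
              (trans (class-cycle (Reach-sym Reach-step)) (trans (class-≁b a≁b) (sym (class-∼b Reach-refl))))
      ... | no i≢a   | no i≢b   = trans (cong class (other i≢a i≢b)) (class-cycle (Reach-sym Reach-step))

    Reach′-merged : ∀ {i j} → Pτ′.Reach i j → Reach i j ⊎ (Reach i a × Reach j b) ⊎ (Reach i b × Reach j a)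
    Reach′-merged {i} {j} r = by-cases (Reach? i b) (Reach? j b)
      where
      open Canon {τ = τ} inj
      eq : class i ≡ class j
      eq = Pτ′.Reach-invariant class-τ′ r
      by-cases : Dec (Reach i b) → Dec (Reach j b) → Reach i j ⊎ (Reach i a × Reach j b) ⊎ (Reach i b × Reach j a)
      by-cases (yes i∼b) (yes j∼b) = inj₁ (Reach-trans i∼b (Reach-sym j∼b))
      by-cases (yes i∼b) (no j≁b)  =
        inj₂ (inj₂ (i∼b , canon≡⇒Reach (trans (sym (class-≁b j≁b)) (trans (sym eq) (class-∼b i∼b)))))
      by-cases (no i≁b)  (yes j∼b) =
        inj₂ (inj₁ (canon≡⇒Reach (trans (sym (class-≁b i≁b)) (trans eq (class-∼b j∼b))) , j∼b))
      by-cases (no i≁b)  (no j≁b)  = inj₁ (canon≡⇒Reach (trans (sym (class-≁b i≁b)) (trans eq (class-≁b j≁b))))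

    private
      α = lookup (canon τ) a
      β = lookup (canon τ) b

    -- The larger minimum `β` is the one cycle minimum that disappears; the union of the two cycles
    -- keeps `α`.
    merge-ordered : toℕ α < toℕ β → cyc τ ≡ suc (cyc τ′)
    merge-ordered α<β = countᵇ-remove {q = Pτ′.isCycleMin} (allFin⁺ n) (∈-allFin β)
      (isCycleMin⁺ λ r → canon-min (Reach-trans (canon-reach b) r))
      (λ t → <⇒≱ α<β (Pτ′.isCycleMin⁻ t (Pτ′.Reach-trans (Reach⊆Reach′ (Reach-sym (canon-reach b)))
        (Pτ′.Reach-trans (Pτ′.Reach-sym a∼′b) (Reach⊆Reach′ (canon-reach a))))))
      (λ x t → isCycleMin⁺ (Pτ′.isCycleMin⁻ t ∘ Reach⊆Reach′))
      keep (_≟ᶠ β)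
      where
      open Canon {τ = τ} inj
      min≤ : ∀ {x y} → T (isCycleMin x) → Reach x y → x ≡ lookup (canon τ) y
      min≤ {x} t r = trans (toℕ-injective (≤-antisym (isCycleMin⁻ t (canon-reach x)) (canon-min Reach-refl))) (Reach⇒canon≡ r)
      keep : ∀ x → T (isCycleMin x) → x ≢ β → T (Pτ′.isCycleMin x)
      keep x t x≢β = Pτ′.isCycleMin⁺ bound
        where
        bound : ∀ {j} → Pτ′.Reach x j → toℕ x ≤ toℕ j
        bound r with Reach′-merged r
        ... | inj₁ x∼j                = isCycleMin⁻ t x∼j
        ... | inj₂ (inj₁ (x∼a , j∼b)) = ≤-trans (≤-reflexive (cong toℕ (min≤ t x∼a)))
                (≤-trans (<⇒≤ α<β) (canon-min (Reach-sym j∼b)))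
        ... | inj₂ (inj₂ (x∼b , _))   = contradiction (min≤ t x∼b) x≢β

  merge : ∀ {a b} → Swapped a b τ τ′ → ¬ Reach a b → cyc τ ≡ suc (cyc τ′)
  merge {a} {b} S a≁b with <-cmp (toℕ (lookup (canon τ) a)) (toℕ (lookup (canon τ) b))
  ... | tri< l _ _  = merge-ordered S a≁b l
  ... | tri≈ _ eq _ = contradiction (Canon.canon≡⇒Reach {τ = τ} inj (toℕ-injective eq)) a≁b
  ... | tri> _ _ l  = merge-ordered (Swapped-ends S) (a≁b ∘ Reach-sym) l

  -- `AvoidsA i` says that `τ` leads from `i` to `b` without meeting `a`. The map `τ′` preserves
  -- this: elsewhere it steps like `τ`, and from `b` it jumps to `lookup τ a`. So the `τ′`-orbit of
  -- `b` misses `a`.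
  split : ∀ {a b} → Swapped a b τ τ′ → a ≢ b → Reach a b → ¬ Pτ′.Reach a b
  split {a} {b} S a≢b a∼b a∼′b = not-a (avoiding (Pτ′.Reach-sym a∼′b))
    where
    open Swapped S
    AvoidsA : Fin n → Set
    AvoidsA i = ∃ λ k → iter τ k i ≡ b × (∀ l → l ≤ k → iter τ l i ≢ a)
    not-a : ¬ AvoidsA a
    not-a (_ , _ , avoid) = avoid 0 z≤n refl
    after-a : AvoidsA (lookup τ a)
    after-a with Reach-trans (Reach-sym (Reach-step {a})) a∼b
    ... | k , eq with least (λ k → iter τ k (lookup τ a) ≟ᶠ b) k eq
    ... | j , _ , hit , min = j , hit , avoid
      where
      avoid : ∀ l → l ≤ j → iter τ l (lookup τ a) ≢ a
      avoid l l≤j back with m≤n⇒m<n∨m≡n l≤j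
      ... | inj₂ refl = a≢b (trans (sym back) hit)
      -- A return to `a` after `l` steps makes `suc l` a period, and `b` would have been met `suc l`
      -- steps earlier.
      ... | inj₁ l<j  = min (j ∸ suc l) (∸-monoʳ-< (s≤s z≤n) l<j) (begin
        iter τ (j ∸ suc l) (lookup τ a)                           ≡⟨ cong (iter τ (j ∸ suc l) ∘ lookup τ) (sym back) ⟩
        iter τ (j ∸ suc l) (iter τ (suc l) (lookup τ a))          ≡⟨ sym (iter-+ (j ∸ suc l) (suc l) _) ⟩
        iter τ (j ∸ suc l + suc l) (lookup τ a)                   ≡⟨ cong (λ m → iter τ m (lookup τ a)) (m∸n+n≡m l<j) ⟩
        iter τ j (lookup τ a)                                     ≡⟨ hit ⟩
        b ∎)
        where open ≡-Reasoning
    step : ∀ {i} → AvoidsA i → AvoidsA (lookup τ′ i)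
    step {i} (k , hit , avoid) with i ≟ᶠ b
    ... | yes refl = subst AvoidsA (sym at-b) after-a
    step {i} (zero , hit , avoid) | no i≢b = contradiction hit i≢b
    step {i} (suc k , hit , avoid) | no i≢b = subst AvoidsA (sym (other (avoid 0 z≤n) i≢b))
      (k , trans (iter-shift k i) hit , λ l l≤k eq → avoid (suc l) (s≤s l≤k) (trans (sym (iter-shift l i)) eq))
    avoiding : ∀ {j} → Pτ′.Reach b j → AvoidsA j
    avoiding (zero  , refl) = 0 , refl , λ { zero _ eq → a≢b (sym eq) }
    avoiding (suc k , refl) = step (avoiding (k , refl))

-- Sums of natural numbers and integers

module ∑ℕ = ListSum +-0-isCommutativeMonoid
module ∑ℤ = ListSum ℤₚ.+-0-isCommutativeMonoid

∑-one : (p : A → Bool) (xs : List A) → ∑ℕ.∑ xs (λ x → ∑ℕ.when (p x) 1) ≡ countᵇ p xs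
∑-one p []       = refl
∑-one p (x ∷ xs) with p x
... | true  = cong suc (∑-one p xs)
... | false = ∑-one p xs

sum-map : (f : A → ℕ) (xs : List A) → sum (map f xs) ≡ ∑ℕ.∑ xs f
sum-map f []       = refl
sum-map f (x ∷ xs) = cong (f x +_) (sum-map f xs)

∑-constant : (p : A → Bool) (z : ℤ) (xs : List A) → ∑ℤ.∑ xs (λ x → ∑ℤ.when (p x) z) ≡ toℤ (countᵇ p xs) *ℤ z
∑-constant p z []       = sym (ℤₚ.*-zeroˡ z)
∑-constant p z (x ∷ xs) with p x
... | true  = trans (cong (z +ℤ_) (∑-constant p z xs)) (sym (ℤₚ.suc-* (toℤ (countᵇ p xs)) z))
... | false = trans (ℤₚ.+-identityˡ _) (∑-constant p z xs)

∑-neg : (xs : List A) (f : A → ℤ) → ∑ℤ.∑ xs (λ x → -ℤ f x) ≡ -ℤ ∑ℤ.∑ xs f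
∑-neg []       f = refl
∑-neg (x ∷ xs) f = trans (cong (-ℤ f x +ℤ_) (∑-neg xs f)) (sym (ℤₚ.neg-distrib-+ (f x) _))

∑-map : (g : A → ℤ) (xs : List A) → ∑ℤ.∑ (map g xs) id ≡ ∑ℤ.∑ xs g
∑-map g []       = refl
∑-map g (x ∷ xs) = cong (g x +ℤ_) (∑-map g xs)

-- Stated for any `S` satisfying the two equations, so it applies to a summation that is accessible
-- only through its computation rules.
∑-unique : (S : List ℤ → ℤ) → S [] ≡ 0ℤ → (∀ z zs → S (z ∷ zs) ≡ z +ℤ S zs) → ∀ zs → S zs ≡ ∑ℤ.∑ zs id
∑-unique S nil step []       = nil
∑-unique S nil step (z ∷ zs) = trans (step z zs) (cong (z +ℤ_) (∑-unique S nil step zs))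

z≡-z⇒z≡0 : ∀ {z} → z ≡ -ℤ z → z ≡ 0ℤ
z≡-z⇒z≡0 {toℤ zero}  _ = refl
z≡-z⇒z≡0 {toℤ (suc _)} ()
z≡-z⇒z≡0 { -[1+ _ ]} ()

-- Permutations and signs

perms : ∀ n → List (Vec (Fin n) n)
perms n = filterᵇ isPerm (allVecs n n)

perms-unique : ∀ n → Unique (perms n)
perms-unique n = filterᵇ-unique isPerm (allVecs-unique n n)

∈-perms⁺ : {τ : Vec (Fin n) n} → Injectiveᵛ τ → τ ∈ perms n
∈-perms⁺ {τ = τ} inj = ∈-filterᵇ⁺ (∈-allVecs τ) (isPerm⁺ τ inj)

∈-perms⁻ : {τ : Vec (Fin n) n} → τ ∈ perms n → Injectiveᵛ τ
∈-perms⁻ {n} {τ} τ∈ = isPerm⁻ τ (proj₂ (∈-filterᵇ⁻ (allVecs n n) τ∈))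

-- The power of -1 with the given exponent; at `n ∸ cyc τ` it is the sign of `τ`.
sgn : ℕ → ℤ
sgn zero    = 1ℤ
sgn (suc k) = -ℤ sgn k

∣sgn∣ : ∀ k → ∣ sgn k ∣ ≡ 1
∣sgn∣ zero    = refl
∣sgn∣ (suc k) = trans (ℤₚ.∣-i∣≡∣i∣ (sgn k)) (∣sgn∣ k)

module _ {n : ℕ} (a b : Fin n) where

  swap-ends : Fin n → Fin n
  swap-ends i with i ≟ᶠ a | i ≟ᶠ b
  ... | yes _ | _     = b
  ... | no _  | yes _ = a
  ... | no _  | no _  = i

  swap-a : swap-ends a ≡ b
  swap-a with a ≟ᶠ a
  ... | yes _ = refl
  ... | no ¬p = contradiction refl ¬p

  swap-b : swap-ends b ≡ a
  swap-b with b ≟ᶠ a | b ≟ᶠ b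
  ... | yes eq | _     = eq
  ... | no _   | yes _ = refl
  ... | no _   | no ¬p = contradiction refl ¬p

  swap-other : ∀ {i} → i ≢ a → i ≢ b → swap-ends i ≡ i
  swap-other {i} i≢a i≢b with i ≟ᶠ a | i ≟ᶠ b
  ... | yes eq | _      = contradiction eq i≢a
  ... | no _   | yes eq = contradiction eq i≢b
  ... | no _   | no _   = refl

  swap-involutive : ∀ i → swap-ends (swap-ends i) ≡ i
  swap-involutive i with i ≟ᶠ a | i ≟ᶠ b
  ... | yes refl | _        = swap-b
  ... | no _     | yes refl = swap-a
  ... | no i≢a   | no i≢b   = swap-other i≢a i≢b

  exchange : Vec (Fin n) n → Vec (Fin n) n
  exchange τ = tabulate (λ i → lookup τ (swap-ends i))

  lookup-exchange : ∀ τ i → lookup (exchange τ) i ≡ lookup τ (swap-ends i)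
  lookup-exchange τ = lookup∘tabulate (λ i → lookup τ (swap-ends i))

  exchange-involutive : ∀ τ → exchange (exchange τ) ≡ τ
  exchange-involutive τ = lookup-injective _ τ λ i →
    trans (lookup-exchange (exchange τ) i) (trans (lookup-exchange τ (swap-ends i)) (cong (lookup τ) (swap-involutive i)))

  exchange-injective : ∀ τ → Injectiveᵛ τ → Injectiveᵛ (exchange τ)
  exchange-injective τ inj {p} {q} eq = trans (sym (swap-involutive p)) (trans (cong swap-ends (inj
    (trans (sym (lookup-exchange τ p)) (trans eq (lookup-exchange τ q))))) (swap-involutive q))

  exchange-swapped : ∀ τ → Swapped a b τ (exchange τ)
  exchange-swapped τ = record
    { at-a  = trans (lookup-exchange τ a) (cong (lookup τ) swap-a)
    ; at-b  = trans (lookup-exchange τ b) (cong (lookup τ) swap-b)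
    ; other = λ i≢a i≢b → trans (lookup-exchange τ _) (cong (lookup τ) (swap-other i≢a i≢b)) }

cyc≤n : (τ : Vec (Fin n) n) → cyc τ ≤ n
cyc≤n {n} τ = ≤-trans (length-filter _ (allFin n)) (≤-reflexive (length-allFin n))

-- The transposition merges two cycles or splits one, and a split is a merge read from `τ′` to `τ`;
-- the number of cycles changes by one either way.
exchange-sgn : {a b : Fin n} {τ : Vec (Fin n) n} → Injectiveᵛ τ → a ≢ b →
  sgn (n ∸ cyc (exchange a b τ)) ≡ -ℤ sgn (n ∸ cyc τ)
exchange-sgn {n} {a} {b} {τ} inj a≢b = by-cases (Reach? a b)
  where
  open Perm τ inj
  τ′ = exchange a b τ
  inj′ : Injectiveᵛ τ′
  inj′ = exchange-injective a b τ inj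
  codim-suc : ∀ {c c′} → c ≡ suc c′ → c ≤ n → n ∸ c′ ≡ suc (n ∸ c)
  codim-suc refl c<n = +-∸-assoc 1 c<n
  by-cases : Dec (Reach a b) → sgn (n ∸ cyc τ′) ≡ -ℤ sgn (n ∸ cyc τ)
  by-cases (no a≁b) = cong sgn (codim-suc {cyc τ} {cyc τ′}
    (Merge.merge {τ = τ} {τ′} inj inj′ (exchange-swapped a b τ) a≁b) (cyc≤n τ))
  by-cases (yes a∼b) = sym (trans (cong (λ k → -ℤ sgn k) (codim-suc {cyc τ′} {cyc τ}
    (Merge.merge {τ = τ′} {τ} inj′ inj (Swapped-sym (exchange-swapped a b τ))
      (Merge.split {τ = τ} {τ′} inj inj′ (exchange-swapped a b τ) a≢b a∼b)) (cyc≤n τ′))) (ℤₚ.neg-involutive _))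

-- The order on flats

T-leFlat⁻ : (Y X : Vec (Fin n) n) → T (leFlat Y X) → ∀ {i j} → lookup Y i ≡ lookup Y j → lookup X i ≡ lookup X j
T-leFlat⁻ Y X t {i} {j} eq = T-==⁻ (T-⇒⁻ {sameBlock Y i j} (T-allP⁻ (T-allP⁻
  {p = λ i → allP λ j → not (sameBlock Y i j) ∨ sameBlock X i j} t i) j) (T-==⁺ eq))

T-leFlat⁺ : (Y X : Vec (Fin n) n) → (∀ {i j} → lookup Y i ≡ lookup Y j → lookup X i ≡ lookup X j) → T (leFlat Y X)
T-leFlat⁺ Y X h = T-allP⁺ λ i → T-allP⁺ λ j → T-⇒⁺ {sameBlock Y i j} (λ t → T-==⁺ (h (T-==⁻ t)))

T-isV⁻ : (X : Vec (Fin n) n) → T (isV X) → ∀ i → lookup X i ≡ i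
T-isV⁻ X t i = T-==⁻ (T-allP⁻ {p = λ i → lookup X i == i} t i)

T-isV⁺ : (X : Vec (Fin n) n) → (∀ i → lookup X i ≡ i) → T (isV X)
T-isV⁺ X h = T-allP⁺ λ i → T-==⁺ (h i)

module _ (X : Vec (Fin n) n) (canonical : T (isCanon X)) where

  private
    spec : ∀ i → T (lookup X (lookup X i) == lookup X i) × T (toℕ (lookup X i) ≤ᵇ toℕ i)
    spec i = to T-∧ (T-allP⁻ {p = λ i → (lookup X (lookup X i) == lookup X i) ∧ (toℕ (lookup X i) ≤ᵇ toℕ i)} canonical i)

  isCanon-idem : ∀ i → lookup X (lookup X i) ≡ lookup X i
  isCanon-idem i = T-==⁻ (proj₁ (spec i))

  isCanon-≤ : ∀ i → toℕ (lookup X i) ≤ toℕ i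
  isCanon-≤ i = ≤ᵇ⇒≤ _ _ (proj₂ (spec i))

∈-flats⁺ : {X : Vec (Fin n) n} → T (isCanon X) → X ∈ flats n
∈-flats⁺ {X = X} = ∈-filterᵇ⁺ (∈-allVecs X)

canon-fibre : {τ : Vec (Fin n) n} → τ ∈ perms n →
  canon τ ∈ flats n × T (eqFlat (canon τ) (canon τ)) × (∀ {Y} → T (eqFlat (canon τ) Y) → Y ≡ canon τ)
canon-fibre {τ = τ} τ∈ = ∈-flats⁺ (Canon.canon-canonical {τ = τ} (∈-perms⁻ {τ = τ} τ∈)) ,
  T-eqFlat⁺ (canon τ) _ refl , λ {Y} t → sym (T-eqFlat⁻ (canon τ) Y t)

flats-unique : ∀ n → Unique (flats n)
flats-unique n = filterᵇ-unique isCanon (allVecs-unique n n)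

-- Block minima of `X` are block minima of the finer `Y`, and where the labels of `i` differ,
-- `lookup Y i` is a minimum for `Y` only. This drop bounds the recursion depth of the Möbius
-- function.
codim-strict : (Y X : Vec (Fin n) n) → T (isCanon Y) → T (isCanon X) → T (leFlat Y X) → ¬ T (eqFlat Y X) →
  codim Y < codim X
codim-strict {n} Y X cY cX le ne with anyᶠ? (λ i → ¬? (lookup Y i ≟ᶠ lookup X i))
... | no none = contradiction (T-eqFlat⁺ Y X (lookup-injective Y X agree)) ne
  where
  agree : ∀ i → lookup Y i ≡ lookup X i
  agree i with lookup Y i ≟ᶠ lookup X i
  ... | yes eq = eq
  ... | no ne′ = contradiction (i , ne′) none
... | yes (i , Yi≢Xi) = ∸-monoʳ-< fewer (≤-trans (length-filter _ (allFin n)) (≤-reflexive (length-allFin n)))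
  where
  root : Vec (Fin n) n → Fin n → Bool
  root Z i = lookup Z i == i
  j = lookup Y i
  Xj≡Xi : lookup X j ≡ lookup X i
  Xj≡Xi = T-leFlat⁻ Y X le (isCanon-idem Y cY i)
  fewer : countᵇ (root X) (allFin n) < countᵇ (root Y) (allFin n)
  fewer = injection⇒length-≤ {xs = j ∷ filterᵇ (root X) (allFin n)} _≡_ (λ { refl refl → refl })
    (All.tabulate (λ { z∈ refl → Yi≢Xi (trans (sym (T-==⁻ (proj₂ (∈-filterᵇ⁻ (allFin n) z∈)))) Xj≡Xi) })
      ∷ filterᵇ-unique (root X) (allFin⁺ n))
    λ { (here refl) → j , ∈-filterᵇ⁺ (∈-allFin j) (T-==⁺ (isCanon-idem Y cY i)) , refl
      ; {x} (there x∈) → x , ∈-filterᵇ⁺ (∈-allFin x)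
          (T-==⁺ (stays x (T-==⁻ (proj₂ (∈-filterᵇ⁻ (allFin n) x∈))))) , refl }
    where
    stays : ∀ x → lookup X x ≡ x → lookup Y x ≡ x
    stays x eq = toℕ-injective (≤-antisym (isCanon-≤ Y cY x) (≤-trans
      (≤-reflexive (cong toℕ (trans (sym eq) (sym (T-leFlat⁻ Y X le (isCanon-idem Y cY x))))))
      (isCanon-≤ X cX (lookup Y x))))

-- The Möbius function

signedCount : Vec (Fin n) n → ℤ
signedCount {n} X = ∑ℤ.∑ (perms n) (λ τ → ∑ℤ.when (eqFlat (canon τ) X) (sgn (n ∸ cyc τ)))

-- All permutations with cycle partition `X` have the same number of cycles, hence equal signs, and
-- nothing cancels within one flat.
∣signedCount∣ : (X : Vec (Fin n) n) → ∣ signedCount X ∣ ≡ countᵇ (λ τ → eqFlat (canon τ) X) (perms n)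
∣signedCount∣ {n} X = begin
  ∣ signedCount X ∣                                                     ≡⟨ cong ∣_∣ (∑ℤ.∑-cong (perms n) same-sign) ⟩
  ∣ ∑ℤ.∑ (perms n) (λ τ → ∑ℤ.when (eqFlat (canon τ) X) (sgn (codim X))) ∣ ≡⟨ cong ∣_∣ (∑-constant _ (sgn (codim X)) (perms n)) ⟩
  ∣ toℤ c *ℤ sgn (codim X) ∣                                              ≡⟨ ℤₚ.abs-* (toℤ c) (sgn (codim X)) ⟩
  c * ∣ sgn (codim X) ∣                                                 ≡⟨ cong (c *_) (∣sgn∣ (codim X)) ⟩
  c * 1                                                                 ≡⟨ *-identityʳ c ⟩
  c ∎
  where
  open ≡-Reasoning
  c = countᵇ (λ τ → eqFlat (canon τ) X) (perms n)
  same-sign : ∀ {τ} → τ ∈ perms n →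
    ∑ℤ.when (eqFlat (canon τ) X) (sgn (n ∸ cyc τ)) ≡ ∑ℤ.when (eqFlat (canon τ) X) (sgn (codim X))
  same-sign {τ} τ∈ with T? (eqFlat (canon τ) X)
  ... | no ¬t rewrite T-¬⇒≡false ¬t = refl
  ... | yes t = cong (∑ℤ.when (eqFlat (canon τ) X) ∘ sgn)
    (trans (sym (Canon.codim-canon {τ = τ} (∈-perms⁻ {τ = τ} τ∈))) (cong codim (T-eqFlat⁻ (canon τ) X t)))

-- Only the identity has all cycles trivial.
signedCount-V : (X : Vec (Fin n) n) → T (isV X) → signedCount X ≡ 1ℤ
signedCount-V {n} X v = trans
  (∑ℤ.∑-delta (λ τ → eqFlat (canon τ) X) (λ τ → sgn (n ∸ cyc τ)) {ι} (perms-unique n) (∈-perms⁺ {τ = ι} ι-injective)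
    (T-eqFlat⁺ (canon ι) X canon-ι) λ {τ} τ∈ t → trivial {τ} (∈-perms⁻ {τ = τ} τ∈) (T-eqFlat⁻ (canon τ) X t))
  (cong sgn (trans (sym (Canon.codim-canon {τ = ι} ι-injective)) (trans (cong codim canon-ι) codim-V)))
  where
  ι : Vec (Fin n) n
  ι = tabulate id
  lookup-ι : ∀ i → lookup ι i ≡ i
  lookup-ι = lookup∘tabulate id
  ι-injective : Injectiveᵛ ι
  ι-injective {p} {q} eq = trans (sym (lookup-ι p)) (trans eq (lookup-ι q))
  iter-ι : ∀ k i → iter ι k i ≡ i
  iter-ι zero    i = refl
  iter-ι (suc k) i = trans (lookup-ι _) (iter-ι k i)
  canon-ι : canon ι ≡ X
  canon-ι = lookup-injective _ X λ i → let k , eq = Canon.canon-reach {τ = ι} ι-injective i in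
    trans (sym eq) (trans (iter-ι k i) (sym (T-isV⁻ X v i)))
  codim-V : codim X ≡ 0
  codim-V = m≤n⇒m∸n≡0 (≤-trans (≤-reflexive (sym (length-allFin n)))
    (injection⇒length-≤ {ys = filterᵇ (λ i → lookup X i == i) (allFin n)} _≡_ (λ { refl refl → refl }) (allFin⁺ n)
      (λ {i} i∈ → i , ∈-filterᵇ⁺ i∈ (T-==⁺ (T-isV⁻ X v i)) , refl)))
  trivial : ∀ {τ} → Injectiveᵛ τ → canon τ ≡ X → τ ≡ ι
  trivial {τ} inj refl = lookup-injective τ ι λ i → trans (sym (T-isV⁻ (canon τ) v (lookup τ i)))
    (trans (sym (Canon.Reach⇒canon≡ {τ = τ} inj (1 , refl))) (trans (T-isV⁻ (canon τ) v i) (sym (lookup-ι i))))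

μFuel-V : ∀ f (X : Vec (Fin n) n) → T (isV X) → μFuel (suc f) X ≡ 1ℤ
μFuel-V f X v rewrite to T-≡ v = refl

-- The summation in μFuel is a local function of Defs and cannot be named; the
-- first underscore is solved to it.
μFuel-step : ∀ f (X : Vec (Fin n) n) → ¬ T (isV X) →
  μFuel (suc f) X ≡ -ℤ ∑ℤ.∑ (filterᵇ (λ Y → leFlat Y X ∧ not (eqFlat Y X)) (flats n)) (μFuel f)
μFuel-step {n} f X ¬v rewrite T-¬⇒≡false ¬v | sym (∑-map (μFuel f) (filterᵇ (λ Y → leFlat Y X ∧ not (eqFlat Y X)) (flats n)))
  with ∑-unique _ refl (λ _ _ → refl) | map (μFuel f) (filterᵇ (λ Y → leFlat Y X ∧ not (eqFlat Y X)) (flats n))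
... | sum-is-∑ | zs = cong -ℤ_ (sum-is-∑ zs)

module _ (X : Vec (Fin n) n) (canonical : T (isCanon X)) (nontrivial : ¬ T (isV X)) where

  private
    moved : ∃ λ a → lookup X a ≢ a
    moved with anyᶠ? (λ i → ¬? (lookup X i ≟ᶠ i))
    ... | yes found = found
    ... | no none   = contradiction (T-isV⁺ X fixed) nontrivial
      where
      fixed : ∀ i → lookup X i ≡ i
      fixed i with lookup X i ≟ᶠ i
      ... | yes eq = eq
      ... | no ne  = contradiction (i , ne) none

    -- The transposition exchanges an element with the different minimum of its block in `X`.
    a = proj₁ moved
    b = lookup X a
    a≢b : a ≢ b
    a≢b eq = proj₂ moved (sym eq)

    below : Vec (Fin n) n → Bool
    below τ = leFlat (canon τ) X

    -- Being below `X` means that labels of `X` are constant along the permutation, and `a` and `b`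
    -- carry the same label.
    below-exchange : ∀ {τ} → Injectiveᵛ τ → T (below τ) → T (below (exchange a b τ))
    below-exchange {τ} inj t = T-leFlat⁺ (canon (exchange a b τ)) X λ eq → Perm.Reach-invariant (exchange a b τ) inj′ {f = lookup X} keeps
      (Canon.canon≡⇒Reach {τ = exchange a b τ} inj′ eq)
      where
      inj′ : Injectiveᵛ (exchange a b τ)
      inj′ = exchange-injective a b τ inj
      X-swap : ∀ i → lookup X (swap-ends a b i) ≡ lookup X i
      X-swap i with i ≟ᶠ a | i ≟ᶠ b
      ... | yes refl | _        = isCanon-idem X canonical a
      ... | no _     | yes refl = sym (isCanon-idem X canonical a)
      ... | no _     | no _     = refl
      X-τ : ∀ i → lookup X (lookup τ i) ≡ lookup X i
      X-τ i = T-leFlat⁻ (canon τ) X t (sym (Canon.Reach⇒canon≡ {τ = τ} inj (1 , refl)))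
      keeps : ∀ i → lookup X (lookup (exchange a b τ) i) ≡ lookup X i
      keeps i = trans (cong (lookup X) (lookup-exchange a b τ i)) (trans (X-τ _) (X-swap i))

    signed : Vec (Fin n) n → ℤ
    signed τ = ∑ℤ.when (below τ) (sgn (n ∸ cyc τ))

    signed-exchange : ∀ {τ} → Injectiveᵛ τ → signed (exchange a b τ) ≡ -ℤ signed τ
    signed-exchange {τ} inj
      rewrite T-⇔⇒≡ {below (exchange a b τ)} {below τ}
        (λ t → subst (T ∘ below) (exchange-involutive a b τ) (below-exchange (exchange-injective a b τ inj) t))
        (below-exchange inj)
      with below τ
    ... | true  = exchange-sgn inj a≢b
    ... | false = refl

  signed-cancel : ∑ℤ.∑ (perms n) (λ τ → ∑ℤ.when (leFlat (canon τ) X) (sgn (n ∸ cyc τ))) ≡ 0ℤ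
  signed-cancel = z≡-z⇒z≡0 (begin
    ∑ℤ.∑ (perms n) signed
      ≡⟨ sym (∑ℤ.∑-involution eqFlat (λ {s} {t} → T-eqFlat⁻ s t) (λ {t} → T-eqFlat⁺ t t refl)
           (exchange a b) (exchange-involutive a b) (perms-unique n)
           (λ {τ} τ∈ → ∈-perms⁺ {τ = exchange a b τ} (exchange-injective a b τ (∈-perms⁻ {τ = τ} τ∈))) signed) ⟩
    ∑ℤ.∑ (perms n) (signed ∘ exchange a b)
      ≡⟨ ∑ℤ.∑-cong (perms n) (λ {τ} τ∈ → signed-exchange {τ} (∈-perms⁻ {τ = τ} τ∈)) ⟩
    ∑ℤ.∑ (perms n) (λ τ → -ℤ signed τ)       ≡⟨ ∑-neg (perms n) signed ⟩
    -ℤ ∑ℤ.∑ (perms n) signed                 ∎)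
    where open ≡-Reasoning

  signedCount-cancel : ∑ℤ.∑ (flats n) (λ Y → ∑ℤ.when (leFlat Y X) (signedCount Y)) ≡ 0ℤ
  signedCount-cancel = trans
    (∑ℤ.∑-fibre (perms n) (λ Y → leFlat Y X) (λ τ Y → eqFlat (canon τ) Y) canon (λ τ → sgn (n ∸ cyc τ)) (flats-unique n)
      canon-fibre)
    signed-cancel

  signedCount-step : signedCount X ≡ -ℤ ∑ℤ.∑ (filterᵇ (λ Y → leFlat Y X ∧ not (eqFlat Y X)) (flats n)) signedCount
  signedCount-step = +-inverse-unique (begin
    signedCount X +ℤ ∑ℤ.∑ (filterᵇ (λ Y → leFlat Y X ∧ not (eqFlat Y X)) (flats n)) signedCount
      ≡⟨ cong₂ _+ℤ_ (sym (∑ℤ.∑-delta (λ Y → eqFlat Y X) signedCount (flats-unique n) (∈-flats⁺ canonical)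
           (T-eqFlat⁺ X X refl) (λ {Y} _ → T-eqFlat⁻ Y X))) (∑ℤ.∑-filterᵇ _ (flats n) signedCount) ⟩
    ∑ℤ.∑ (flats n) (λ Y → ∑ℤ.when (eqFlat Y X) (signedCount Y)) +ℤ
    ∑ℤ.∑ (flats n) (λ Y → ∑ℤ.when (leFlat Y X ∧ not (eqFlat Y X)) (signedCount Y))
      ≡⟨ sym (∑ℤ.∑-∙ (flats n) _ _) ⟩
    ∑ℤ.∑ (flats n) (λ Y → ∑ℤ.when (eqFlat Y X) (signedCount Y) +ℤ ∑ℤ.when (leFlat Y X ∧ not (eqFlat Y X)) (signedCount Y))
      ≡⟨ ∑ℤ.∑-cong (flats n) (λ {Y} _ → sym (separate Y)) ⟩
    ∑ℤ.∑ (flats n) (λ Y → ∑ℤ.when (leFlat Y X) (signedCount Y))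
      ≡⟨ signedCount-cancel ⟩
    0ℤ ∎)
    where
    open ≡-Reasoning
    +-inverse-unique : ∀ {y z} → y +ℤ z ≡ 0ℤ → y ≡ -ℤ z
    +-inverse-unique {y} {z} eq = begin
      y                       ≡⟨ sym (ℤₚ.+-identityʳ y) ⟩
      y +ℤ 0ℤ                 ≡⟨ cong (y +ℤ_) (sym (ℤₚ.+-inverseʳ z)) ⟩
      y +ℤ (z +ℤ (-ℤ z))      ≡⟨ sym (ℤₚ.+-assoc y z (-ℤ z)) ⟩
      (y +ℤ z) +ℤ (-ℤ z)      ≡⟨ cong (_+ℤ (-ℤ z)) eq ⟩
      0ℤ +ℤ (-ℤ z)            ≡⟨ ℤₚ.+-identityˡ (-ℤ z) ⟩
      -ℤ z                    ∎
    eq⇒le : ∀ {Y} → T (eqFlat Y X) → T (leFlat Y X)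
    eq⇒le {Y} t with refl ← T-eqFlat⁻ Y X t = T-leFlat⁺ X X id
    separate : ∀ Y → ∑ℤ.when (leFlat Y X) (signedCount Y) ≡
      ∑ℤ.when (eqFlat Y X) (signedCount Y) +ℤ ∑ℤ.when (leFlat Y X ∧ not (eqFlat Y X)) (signedCount Y)
    separate Y with eqFlat Y X | leFlat Y X | eq⇒le {Y}
    ... | true  | true  | _ = sym (ℤₚ.+-identityʳ _)
    ... | true  | false | h = contradiction tt h
    ... | false | true  | _ = sym (ℤₚ.+-identityˡ _)
    ... | false | false | _ = refl

-- Fuel exceeding the codimension never runs out, because every smaller flat has smaller
-- codimension.
μFuel≡signedCount : ∀ f (X : Vec (Fin n) n) → T (isCanon X) → codim X < f → μFuel f X ≡ signedCount X
μFuel≡signedCount (suc f) X canonical bound with T? (isV X)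
... | yes v = trans (μFuel-V f X v) (sym (signedCount-V X v))
... | no ¬v = trans (μFuel-step f X ¬v) (trans (cong -ℤ_ (∑ℤ.∑-cong _ smaller)) (sym (signedCount-step X canonical ¬v)))
  where
  smaller : ∀ {Y} → Y ∈ filterᵇ (λ Y → leFlat Y X ∧ not (eqFlat Y X)) (flats _) → μFuel f Y ≡ signedCount Y
  smaller {Y} Y∈ with ∈-filterᵇ⁻ (flats _) Y∈
  ... | Y∈′ , t with ∈-filterᵇ⁻ (allVecs _ _) Y∈′ | to T-∧ t
  ... | _ , cY | le , ne = μFuel≡signedCount f Y cY
    (≤-trans (codim-strict Y X cY canonical le (λ e → subst T (to T-not-≡ ne) e)) (≤-pred bound))

∣μV∣ : (X : Vec (Fin n) n) → T (isCanon X) → ∣ μV X ∣ ≡ countᵇ (λ τ → eqFlat (canon τ) X) (perms n)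
∣μV∣ {n} X canonical = trans
  (cong ∣_∣ (μFuel≡signedCount (suc n) X canonical (s≤s (m∸n≤m n (countᵇ (λ i → lookup X i == i) (allFin n))))))
  (∣signedCount∣ X)

-- Flats meeting the cone

module _ (P : Poset n) {τ : Vec (Fin n) n} (inj : Injectiveᵛ τ) where
  open Perm τ inj
  open Foata P
  open Transversality P {τ} inj

  -- The coordinates of a common point form a potential: constant on cycles and strictly increasing
  -- along `P`.
  Meets⇒transverse : Meets P (canon τ) → IsPTransverseCycles P τ
  Meets⇒transverse (x , x-block , x-≺) = potential⇒transverse _<ℚ_ x (ℚₚ.<-irrefl refl) ℚₚ.<-trans
    (λ r → x-block _ _ (T-==⁺ (Canon.Reach⇒canon≡ {τ = τ} inj r))) (x-≺ _ _)

  transverse⇒Meets : IsPTransverseCycles P τ → Meets P (canon τ)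
  transverse⇒Meets transverse = (λ i → fromℕ (lev i)) ,
    (λ i j t → cong fromℕ (Reach-invariant lev-τ (Canon.canon≡⇒Reach {τ = τ} inj (T-==⁻ t)))) ,
    λ i j i≺j → *<* (subst₂ ℤ._<_ (sym (ℤₚ.*-identityʳ _)) (sym (ℤₚ.*-identityʳ _)) (ℤ.+<+ (lev-≺ i≺j)))
    where
    open Layout (transverse⇒Layout transverse)
    fromℕ : ℕ → ℚ
    -- The `0` is the denominator minus one.
    fromℕ k = mkℚ (toℤ k) 0 (coprime-sym (1-coprimeTo k))

-- Comparison of coefficients

module _ (P : Poset n) (d : ∀ X → Dec (Meets P X)) (k : ℕ) where
  open Correspondence P

  private
    counts : Vec (Fin n) n → Bool
    counts X = ⌊ d X ⌋ ∧ (codim X ≡ᵇ k)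

    cCoeff≡count : cCoeff P d k ≡ countᵇ (counts ∘ canon) (perms n)
    cCoeff≡count = begin
      cCoeff P d k
        ≡⟨ sum-map _ (flats n) ⟩
      ∑ℕ.∑ (flats n) (λ X → ∑ℕ.when (counts X) ∣ μV X ∣)
        ≡⟨ ∑ℕ.∑-cong (flats n) (λ {X} X∈ → cong (∑ℕ.when (counts X)) (trans
             (∣μV∣ X (proj₂ (∈-filterᵇ⁻ (allVecs n n) X∈))) (sym (∑-one _ (perms n))))) ⟩
      ∑ℕ.∑ (flats n) (λ X → ∑ℕ.when (counts X) (∑ℕ.∑ (perms n) λ τ → ∑ℕ.when (eqFlat (canon τ) X) 1))
        ≡⟨ ∑ℕ.∑-fibre (perms n) counts (λ τ X → eqFlat (canon τ) X) canon (λ _ → 1) (flats-unique n)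
             canon-fibre ⟩
      ∑ℕ.∑ (perms n) (λ τ → ∑ℕ.when (counts (canon τ)) 1)
        ≡⟨ ∑-one _ (perms n) ⟩
      countᵇ (counts ∘ canon) (perms n) ∎
      where open ≡-Reasoning

  -- Transverse permutations are counted as permutations whose canonical flat is accepted by `d`;
  -- `SortedBy` matches them with linear extensions, giving one inequality in each direction.
  cCoeff≡linExtCoeff : cCoeff P d k ≡ linExtCoeff P k
  cCoeff≡linExtCoeff = trans cCoeff≡count (≤-antisym
    (countᵇ-≤ (λ τ σ → Injectiveᵛ σ × SortedBy τ σ)
      (λ {τ} {τ′} {σ} (inj , s) (_ , s′) → SortedBy-injective {τ} {τ′} {σ} inj s s′) (perms-unique n) forth)
    (countᵇ-≤ (λ σ τ → Injectiveᵛ σ × SortedBy τ σ)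
      (λ {σ} {σ′} {τ} (inj , s) (inj′ , s′) → SortedBy-functional {τ} {σ} {σ′} inj inj′ s s′) (allVecs-unique n n) back))
    where
    same-degree : ∀ {τ σ} → Injectiveᵛ σ → SortedBy τ σ → codim (canon τ) ≡ n ∸ LRmax P σ
    same-degree {τ} {σ} inj s = trans (Canon.codim-canon {τ = τ} (proj₁ s)) (cong (n ∸_) (SortedBy-cyc {τ} {σ} inj s))

    forth : ∀ {τ} → τ ∈ perms n → T (counts (canon τ)) → ∃ λ σ → σ ∈ allVecs n n ×
      T (isPerm σ ∧ isLinExt P σ ∧ ((n ∸ LRmax P σ) ≡ᵇ k)) × Injectiveᵛ σ × SortedBy τ σ
    forth {τ} τ∈ t with to T-∧ t
    ... | meets , degree
      with linearise (τ , isPerm⁺ τ (∈-perms⁻ {τ = τ} τ∈) ,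
        Meets⇒transverse P {τ} (∈-perms⁻ {τ = τ} τ∈) (toWitness {a? = d (canon τ)} meets))
    ... | (σ , perm , lin) , s = σ , ∈-allVecs σ ,
      from T-∧ (perm , from T-∧ (lin , subst (λ c → T (c ≡ᵇ k)) (same-degree {τ} {σ} (isPerm⁻ σ perm) s) degree)) ,
      isPerm⁻ σ perm , s

    back : ∀ {σ} → σ ∈ allVecs n n → T (isPerm σ ∧ isLinExt P σ ∧ ((n ∸ LRmax P σ) ≡ᵇ k)) →
      ∃ λ τ → τ ∈ perms n × T (counts (canon τ)) × Injectiveᵛ σ × SortedBy τ σ
    back {σ} _ t with to (T-∧ {isPerm σ}) t
    ... | perm , t′ with to (T-∧ {isLinExt P σ}) t′
    ... | lin , degree with delinearise (σ , perm , lin)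
    ... | (τ , τ-perm , transverse) , s = τ , ∈-perms⁺ (isPerm⁻ τ τ-perm) ,
      from T-∧ (fromWitness {a? = d (canon τ)} (transverse⇒Meets P {τ} (isPerm⁻ τ τ-perm) transverse) ,
        subst (λ c → T (c ≡ᵇ k)) (sym (same-degree {τ} {σ} (isPerm⁻ σ perm) s)) degree) ,
      isPerm⁻ σ perm , s

theorem1p2 : (n : ℕ) (P : Poset n) →
    (Σ (STransverse P → LinExt P) λ Φ →
        (∀ (τ τ′ : STransverse P) → proj₁ (Φ τ) ≡ proj₁ (Φ τ′) → proj₁ τ ≡ proj₁ τ′)
      × (∀ (σ : LinExt P) → ∃ λ (τ : STransverse P) → proj₁ (Φ τ) ≡ proj₁ σ)
      × (∀ (τ : STransverse P) → cyc (proj₁ τ) ≡ LRmax P (proj₁ (Φ τ))))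
    × ((d : ∀ X → Dec (Meets P X)) → ∀ k → cCoeff P d k ≡ linExtCoeff P k)
theorem1p2 n P = (Φ , Φ-injective , Φ-surjective , Φ-cyc) , cCoeff≡linExtCoeff P
  where
  open Correspondence P
  Φ : STransverse P → LinExt P
  Φ τ = proj₁ (linearise τ)
  Φ-sorted : ∀ τ → SortedBy (proj₁ τ) (proj₁ (Φ τ))
  Φ-sorted τ = proj₂ (linearise τ)
  perm : (σ : LinExt P) → Injectiveᵛ (proj₁ σ)
  perm (σ , p , _) = isPerm⁻ σ p
  -- Only the underlying vectors are compared, since elements of `STransverse P` also carry proofs.
  Φ-injective : ∀ τ τ′ → proj₁ (Φ τ) ≡ proj₁ (Φ τ′) → proj₁ τ ≡ proj₁ τ′
  Φ-injective τ τ′ eq = SortedBy-injective {proj₁ τ} {proj₁ τ′} {proj₁ (Φ τ)} (perm (Φ τ)) (Φ-sorted τ)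
    (subst (SortedBy (proj₁ τ′)) (sym eq) (Φ-sorted τ′))
  Φ-surjective : ∀ σ → ∃ λ τ → proj₁ (Φ τ) ≡ proj₁ σ
  Φ-surjective σ = let τ , s = delinearise σ in
    τ , SortedBy-functional {proj₁ τ} {proj₁ (Φ τ)} {proj₁ σ} (perm (Φ τ)) (perm σ) (Φ-sorted τ) s
  Φ-cyc : ∀ τ → cyc (proj₁ τ) ≡ LRmax P (proj₁ (Φ τ))
  Φ-cyc τ = SortedBy-cyc {proj₁ τ} {proj₁ (Φ τ)} (perm (Φ τ)) (Φ-sorted τ)
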